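{- There exists an absolute constant $C>0$ such that for every $d\ge 1$ and every function $f\colon\{0,1\}^d\to\mathbb{R}$, \[ \mathbb{E}_{\boldsymbol{x}\sim\{0,1\}^d}\Big[\sqrt{I_f^-(\boldsymbol{x})}\Big]\ \ge\ C\cdot\varepsilon(f), \] where $\boldsymbol{x}$ is uniform on $\{0,1\}^d$.
   Context: The directed $d$-dimensional hypercube has vertex set $\{0,1\}^d$ and edges the ordered pairs $(x,y)$ such that there is a unique $i\in[d]$ with $x_i=0$, $y_i=1$, and $x_j=y_j$ for all $j\neq i$. The partial order is $x\preceq y$ iff $x_i\le y_i$ for all $i$. A function $g\colon\{0,1\}^d\to\mathbb{R}$ is monotone if $g(x)\le g(y)$ whenever $x\preceq y$. The distance to monotonicity $\varepsilon(f)$ is the minimum of $\Pr_{\boldsymbol{x}}[f(\boldsymbol{x})\ne g(\boldsymbol{x})]$ over monotone $g\colon\{0,1\}^d\to\mathbb{R}$ ($\boldsymbol{x}$ uniform). An edge $(x,y)$ is violated by $f$ if $f(x)>f(y)$; $\mathcal{S}_f^-$ denotes the set of violated edges, and $I_f^-(x)=|\{y:(x,y)\in\mathcal{S}_f^-\}|$ is the number of outgoing violated edges at $x$.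
   Formalization: The function f, and the monotone functions g to which it is compared, take rational instead of real values; the real case follows since only the order of the finitely many values of f matters. -}

module Defs where

open import Data.Bool using (Bool; true; false)
import Data.Bool as B
open import Data.Nat using (ℕ; zero; suc)
open import Data.Fin using (Fin)
open import Data.List using (List; []; _∷_; _++_; map; filter; length; sum; foldr)
open import Data.List.Base using (allFin)
open import Data.Vec using (Vec; []; _∷_; lookup; _[_]≔_)
open import Data.Vec.Relation.Binary.Pointwise.Inductive using (Pointwise)
open import Data.Rational using (ℚ; _<_; _≤_; _+_; 0ℚ)
open import Data.Rational.Properties using (_<?_; _≟_)
open import Relation.Nullary using (¬?)
open import Relation.Nullary.Decidable using (_×-dec_)
open import Data.Bool.Properties using () renaming (_≟_ to _≟B_)

Cube : ℕ → Set
Cube d = Vec Bool d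

allCube : (d : ℕ) → List (Cube d)
allCube zero    = [] ∷ []
allCube (suc d) = map (false ∷_) (allCube d) ++ map (true ∷_) (allCube d)

_⪯_ : ∀ {d} → Cube d → Cube d → Set
_⪯_ = Pointwise B._≤_

Monotone : ∀ {d} → (Cube d → ℚ) → Set
Monotone {d} g = ∀ (x y : Cube d) → x ⪯ y → g x ≤ g y

-- I_f^-(x): number of outgoing violated edges at x.  The out-edges of x are
-- exactly (x , x[i]≔1) for coordinates i with x_i = 0; such an edge is violated
-- iff f(x) > f(x[i]≔1).
Iminus : ∀ {d} → (Cube d → ℚ) → Cube d → ℕ
Iminus {d} f x =
  length (filter (λ i → (lookup x i ≟B false) ×-dec (f (x [ i ]≔ true) <? f x))
                 (allFin d))

-- Number of points where f and g disagree (= 2^d · Pr_x[f(x) ≠ g(x)]).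
disagree : ∀ {d} → (Cube d → ℚ) → (Cube d → ℚ) → ℕ
disagree {d} f g = length (filter (λ x → ¬? (f x ≟ g x)) (allCube d))

sumCube : ∀ {d} → (Cube d → ℚ) → ℚ
sumCube {d} r = foldr (λ x acc → r x + acc) 0ℚ (allCube d)

{-# OPTIONS --safe #-}
-- Boolean functions.  Repair the violated pairs of f in the directions of S, direction i towards 1 or
-- towards 0 according to a random bit z_i.  Since the square root is concave, the map
-- S ↦ repair (U ∩ S) z f x has, on average over x and z, root-sensitivity at most the energy
-- 𝔼 √(violated edges of f in the directions of U).  The one-sided Talagrand inequality
-- var (μ A) ≤ 𝔼 (1_A √sens_A) then makes the repairs along S and along its complement close to each other.
-- Split U into eight random cells, ordered by a Gray code.  Repairs of f along consecutive cells
-- are close, hence so are the repair of f along the last cell and a function obtained by repairing all cells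
-- one after the other, which is monotone.  Repairing one cell moves f by at most twice its distance to
-- monotonicity in the directions of that cell, and a random cell carries at most (3/4)³ < 1/2 of the energy.
-- So a constant K for which the theorem holds may be replaced by 27/32 K + 28, and iteration
-- turns the trivial constant 2^d into an absolute one.
--
-- Rational values.  Let h be a monotone function that is locally optimal for the ℓ₁-distance to the rank ρ of f.
-- Cutting ρ at height t inside {h = t}, and extending by 0 on {h < t} and by 1 on {h > t}, gives Boolean functions
-- whose violated edges are violated by f and lie in the disjoint sets {h = t}.  By optimality of h
-- their distance to monotonicity is at least the measure of {h = t < ρ}, respectively {ρ < t = h}; sum over t.
module Submission where

open import Defs
open import Data.Bool using (Bool; true; false; not; _∧_; _∨_; _xor_; if_then_else_)
import Data.Bool as B
import Data.Bool.Properties as Boolₚ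
open import Data.Nat using (ℕ; zero; suc; _≥_; z≤n; s≤s)
import Data.Nat as ℕ
import Data.Nat.Properties as ℕₚ
open import Data.Product using (Σ; _×_; _,_; proj₁; proj₂; ∃)
open import Data.Sum using (_⊎_; inj₁; inj₂)
open import Data.Empty using (⊥-elim)
open import Data.Unit using (⊤; tt)
open import Data.List using (List; []; _∷_; _++_; map; filter; length; foldr; tabulate; allFin)
import Data.List.Properties as Listₚ
open import Data.List.Relation.Unary.All using (All; []; _∷_)
open import Data.Rational using (ℚ; _<_; _≤_; _*_; _+_; _-_; -_; 0ℚ; 1ℚ; ½; 1/_)
import Data.Rational as ℚ
import Data.Rational.Properties as ℚₚ
import Data.Rational.Unnormalised as ℚᵘ
import Data.Rational.Unnormalised.Properties as ℚᵘₚ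
open import Data.Integer using (+_)
import Data.Integer as ℤ
import Data.Integer.Properties as ℤₚ
open import Data.Rational using (_/_)
open import Data.Vec using ([]; _∷_; zipWith; replicate; lookup; _[_]≔_)
import Data.Vec as Vec
open import Data.Vec.Relation.Binary.Pointwise.Inductive using ([]; _∷_)
open import Data.Fin using (Fin; zero; suc)
open import Relation.Nullary using (yes; no; ¬_; Dec; does; ¬?)
open import Relation.Nullary.Decidable using (dec⇒maybe; toWitness; _×-dec_)
open import Relation.Binary.PropositionalEquality using (_≡_; _≢_; refl; sym; trans; cong; cong₂; subst; subst₂; module ≡-Reasoning)
open import Tactic.RingSolver.Core.AlmostCommutativeRing using (AlmostCommutativeRing; fromCommutativeRing)
open import Tactic.RingSolver using (solve-∀)
import Data.Nat.Tactic.RingSolver as ℕ-RingSolver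

-- Inequalities between rationals

ℚ-ring : AlmostCommutativeRing _ _
ℚ-ring = fromCommutativeRing ℚₚ.+-*-commutativeRing λ x → dec⇒maybe (0ℚ ℚₚ.≟ x)

p≤q⇒0≤q-p : ∀ {p q} → p ≤ q → 0ℚ ≤ q - p
p≤q⇒0≤q-p {p} {q} p≤q = subst (_≤ q - p) (ℚₚ.+-inverseʳ p) (ℚₚ.+-monoˡ-≤ (- p) p≤q)

≤-from-diff : ∀ {p q c} → q ≡ p + c → 0ℚ ≤ c → p ≤ q
≤-from-diff {p} {q} {c} eq 0≤c = subst₂ _≤_ (ℚₚ.+-identityʳ p) (sym eq) (ℚₚ.+-monoʳ-≤ p 0≤c)

0≤p+q : ∀ {p q} → 0ℚ ≤ p → 0ℚ ≤ q → 0ℚ ≤ p + q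
0≤p+q = ℚₚ.+-mono-≤

0≤p*q : ∀ {p q} → 0ℚ ≤ p → 0ℚ ≤ q → 0ℚ ≤ p * q
0≤p*q {p} {q} 0≤p 0≤q = ℚₚ.nonNegative⁻¹ _ {{ℚₚ.nonNeg*nonNeg⇒nonNeg p {{ℚ.nonNegative 0≤p}} q {{ℚ.nonNegative 0≤q}}}}

*-monoˡ : ∀ {r p q} → 0ℚ ≤ r → p ≤ q → r * p ≤ r * q
*-monoˡ {r} 0≤r = ℚₚ.*-monoˡ-≤-nonNeg r {{ℚ.nonNegative 0≤r}}

*-mono : ∀ {p q r s} → 0ℚ ≤ p → p ≤ q → 0ℚ ≤ r → r ≤ s → p * r ≤ q * s
*-mono {p} {q} {r} {s} 0≤p p≤q 0≤r r≤s =
  ℚₚ.≤-trans (*-monoˡ 0≤p r≤s) (subst₂ _≤_ (ℚₚ.*-comm s p) (ℚₚ.*-comm s q) (*-monoˡ (ℚₚ.≤-trans 0≤r r≤s) p≤q))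

*-cancelˡ : ∀ {r p q} → 0ℚ < r → r * p ≤ r * q → p ≤ q
*-cancelˡ {r} 0<r = ℚₚ.*-cancelˡ-≤-pos r {{ℚ.positive 0<r}}

0≤p*p : ∀ p → 0ℚ ≤ p * p
0≤p*p p with ℚₚ.≤-total 0ℚ p
... | inj₁ 0≤p = 0≤p*q 0≤p 0≤p
... | inj₂ p≤0 = subst (0ℚ ≤_) (lem p) (0≤p*q 0≤-p 0≤-p)
  where
  0≤-p = ℚₚ.neg-antimono-≤ p≤0
  lem : ∀ p → (- p) * (- p) ≡ p * p
  lem = solve-∀ ℚ-ring

square-cancel-≤ : ∀ {p q} → 0ℚ ≤ q → p * p ≤ q * q → p ≤ q
square-cancel-≤ {p} {q} 0≤q p²≤q² with p ℚₚ.≤? q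
... | yes p≤q = p≤q
... | no p≰q = ⊥-elim (ℚₚ.<-irrefl refl (ℚₚ.≤-<-trans p²≤q² (ℚₚ.≤-<-trans q²≤pq pq<p²)))
  where
  q<p = ℚₚ.≰⇒> p≰q
  0<p = ℚₚ.≤-<-trans 0≤q q<p
  q²≤pq : q * q ≤ p * q
  q²≤pq = *-mono 0≤q (ℚₚ.<⇒≤ q<p) 0≤q ℚₚ.≤-refl
  pq<p² : p * q < p * p
  pq<p² = ℚₚ.*-monoʳ-<-pos p {{ℚ.positive 0<p}} q<p

-- A recursive form of `+ n / 1` that suits induction; `fromℕ≡/1` translates back at the end.
fromℕ : ℕ → ℚ
fromℕ zero    = 0ℚ
fromℕ (suc n) = 1ℚ + fromℕ n

fromℕ≡/1 : ∀ n → fromℕ n ≡ + n / 1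
fromℕ≡/1 zero    = refl
fromℕ≡/1 (suc n) = trans (cong (λ h → 1ℚ + h) (fromℕ≡/1 n)) (ℚₚ.toℚᵘ-injective (begin
  ℚ.toℚᵘ (1ℚ + + n / 1)              ≈⟨ ℚₚ.toℚᵘ-homo-+ 1ℚ (+ n / 1) ⟩
  ℚ.toℚᵘ 1ℚ ℚᵘ.+ ℚ.toℚᵘ (+ n / 1)    ≈⟨ ℚᵘₚ.+-congʳ ℚᵘ.1ℚᵘ (ℚₚ.toℚᵘ-fromℚᵘ (ℚᵘ.mkℚᵘ (+ n) 0)) ⟩
  ℚᵘ.1ℚᵘ ℚᵘ.+ ℚᵘ.mkℚᵘ (+ n) 0        ≈⟨ ℚᵘ.*≡* (cong (λ k → (+ 1 ℤ.+ k) ℤ.* + 1) (ℤₚ.*-identityʳ (+ n))) ⟩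
  ℚᵘ.mkℚᵘ (+ suc n) 0                ≈⟨ ℚᵘₚ.≃-sym (ℚₚ.toℚᵘ-fromℚᵘ (ℚᵘ.mkℚᵘ (+ suc n) 0)) ⟩
  ℚ.toℚᵘ (+ suc n / 1)               ∎))
  where open ℚᵘₚ.≃-Reasoning

0≤1ℚ : 0ℚ ≤ 1ℚ
0≤1ℚ = toWitness {a? = 0ℚ ℚₚ.≤? 1ℚ} _

0≤½ : 0ℚ ≤ ½
0≤½ = toWitness {a? = 0ℚ ℚₚ.≤? ½} _

fromℕ-nonNeg : ∀ n → 0ℚ ≤ fromℕ n
fromℕ-nonNeg zero    = ℚₚ.≤-refl
fromℕ-nonNeg (suc n) = 0≤p+q 0≤1ℚ (fromℕ-nonNeg n)

fromℕ-+ : ∀ m n → fromℕ (m ℕ.+ n) ≡ fromℕ m + fromℕ n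
fromℕ-+ zero n = sym (ℚₚ.+-identityˡ _)
fromℕ-+ (suc m) n = begin
  1ℚ + fromℕ (m ℕ.+ n)       ≡⟨ cong (λ h → 1ℚ + h) (fromℕ-+ m n) ⟩
  1ℚ + (fromℕ m + fromℕ n)   ≡⟨ sym (ℚₚ.+-assoc 1ℚ (fromℕ m) (fromℕ n)) ⟩
  1ℚ + fromℕ m + fromℕ n     ∎
  where open ≡-Reasoning

fromℕ-mono : ∀ {m n} → m ℕ.≤ n → fromℕ m ≤ fromℕ n
fromℕ-mono {m} {n} m≤n =
  ≤-from-diff (trans (cong fromℕ (sym (ℕₚ.m+[n∸m]≡n m≤n))) (fromℕ-+ m (n ℕ.∸ m))) (fromℕ-nonNeg (n ℕ.∸ m))

-- A rational square root

inv : ℚ → ℚ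
inv p with p ℚₚ.≟ 0ℚ
-- A default value that makes `inv` total, so that `root` can be defined before its positivity is
-- known.
... | yes _   = 0ℚ
... | no p≢0 = (1/ p) {{ℚ.≢-nonZero p≢0}}

*-inv : ∀ {p} → 0ℚ < p → p * inv p ≡ 1ℚ
*-inv {p} 0<p with p ℚₚ.≟ 0ℚ
... | yes p≡0 = ⊥-elim (ℚₚ.<-irrefl (sym p≡0) 0<p)
... | no p≢0  = ℚₚ.*-inverseʳ p {{ℚ.≢-nonZero p≢0}}

-- A rational substitute for √n: concave, and n ≤ (root n)² ≤ (9/8) n.
root : ℕ → ℚ
root zero          = 0ℚ
root (suc zero)    = 1ℚ
root (suc (suc n)) = root (suc n) + ½ * inv (root (suc n))

rootStep : ℕ → ℚ
rootStep zero    = 1ℚ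
rootStep (suc n) = ½ * inv (root (suc n))

root-suc : ∀ n → root (suc n) ≡ root n + rootStep n
root-suc zero    = refl
root-suc (suc n) = refl

inv-pos : ∀ {p} → 0ℚ < p → 0ℚ < inv p
inv-pos {p} 0<p with inv p ℚₚ.≤? 0ℚ
... | no q≰0  = ℚₚ.≰⇒> q≰0
... | yes q≤0 = ⊥-elim (ℚₚ.<-irrefl refl (ℚₚ.<-≤-trans (toWitness {a? = 0ℚ ℚₚ.<? 1ℚ} _) 1≤0))
  where
  1≤0 : 1ℚ ≤ 0ℚ
  1≤0 = subst₂ _≤_ (*-inv 0<p) (ℚₚ.*-zeroʳ p) (*-monoˡ (ℚₚ.<⇒≤ 0<p) q≤0)

0<½*p : ∀ {p} → 0ℚ < p → 0ℚ < ½ * p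
0<½*p {p} 0<p = subst (_< ½ * p) (ℚₚ.*-zeroʳ ½) (ℚₚ.*-monoʳ-<-pos ½ 0<p)

root-pos : ∀ n → 0ℚ < root (suc n)
root-pos zero    = toWitness {a? = 0ℚ ℚₚ.<? 1ℚ} _
root-pos (suc n) = ℚₚ.+-mono-< (root-pos n) (0<½*p (inv-pos (root-pos n)))

rootStep-pos : ∀ n → 0ℚ < rootStep n
rootStep-pos zero    = toWitness {a? = 0ℚ ℚₚ.<? 1ℚ} _
rootStep-pos (suc n) = 0<½*p (inv-pos (root-pos n))

root-nonNeg : ∀ n → 0ℚ ≤ root n
root-nonNeg zero    = ℚₚ.≤-refl
root-nonNeg (suc n) = ℚₚ.<⇒≤ (root-pos n)

root*rootStep : ∀ n → root (suc n) * rootStep (suc n) ≡ ½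
root*rootStep n = trans (lem (root (suc n)) (inv (root (suc n)))) (cong (½ *_) (*-inv (root-pos n)))
  where
  lem : ∀ p q → p * (½ * q) ≡ ½ * (p * q)
  lem = solve-∀ ℚ-ring

-- The step `w` is chosen with `2 r w = 1`, so the square grows by 1 and a surplus `w²`. The sign of
-- the surplus gives `n≤root²`, its size gives `root²≤9/8n`.
root²-suc : ∀ n → root (suc (suc n)) * root (suc (suc n)) ≡ root (suc n) * root (suc n) + 1ℚ + rootStep (suc n) * rootStep (suc n)
root²-suc n = trans (lem r w) (cong (λ h → r * r + (h + h) + w * w) (root*rootStep n))
  where
  r = root (suc n)
  w = rootStep (suc n)
  lem : ∀ r w → (r + w) * (r + w) ≡ r * r + (r * w + r * w) + w * w
  lem = solve-∀ ℚ-ring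

n≤root² : ∀ n → fromℕ n ≤ root n * root n
n≤root² zero       = ℚₚ.≤-refl
n≤root² (suc zero) = ℚₚ.≤-refl
n≤root² (suc (suc n)) = begin
  1ℚ + fromℕ (suc n)                        ≤⟨ ℚₚ.+-monoʳ-≤ 1ℚ (n≤root² (suc n)) ⟩
  1ℚ + root (suc n) * root (suc n)          ≡⟨ ℚₚ.+-comm 1ℚ (root (suc n) * root (suc n)) ⟩
  root (suc n) * root (suc n) + 1ℚ          ≤⟨ ≤-from-diff (root²-suc n) (0≤p*p (rootStep (suc n))) ⟩
  root (suc (suc n)) * root (suc (suc n))   ∎
  where open ℚₚ.≤-Reasoning

9/8 : ℚ
9/8 = + 9 / 8

1/8 : ℚ
1/8 = + 1 / 8

-- From `r w = ½` and `r² ≥ 2`; hence from 2 on the square of the root grows by at most 9/8 per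
-- step.
rootStep²≤1/8 : ∀ n → rootStep (suc (suc n)) * rootStep (suc (suc n)) ≤ 1/8
rootStep²≤1/8 n = *-cancelˡ (toWitness {a? = 0ℚ ℚₚ.<? fromℕ 2} _) (begin
  fromℕ 2 * (w * w)           ≤⟨ *-mono (fromℕ-nonNeg 2) 2≤r² (0≤p*p w) ℚₚ.≤-refl ⟩
  (r * r) * (w * w)           ≡⟨ lem r w ⟩
  (r * w) * (r * w)           ≡⟨ cong₂ _*_ (root*rootStep (suc n)) (root*rootStep (suc n)) ⟩
  ½ * ½                       ≡⟨⟩
  fromℕ 2 * 1/8               ∎)
  where
  open ℚₚ.≤-Reasoning
  r = root (suc (suc n))
  w = rootStep (suc (suc n))
  2≤r² : fromℕ 2 ≤ r * r
  2≤r² = ℚₚ.≤-trans (fromℕ-mono {2} {suc (suc n)} (s≤s (s≤s z≤n))) (n≤root² (suc (suc n)))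
  lem : ∀ r w → (r * r) * (w * w) ≡ (r * w) * (r * w)
  lem = solve-∀ ℚ-ring

-- The constant is dictated by n = 2, where the root is 3/2 and equality holds.
root²≤9/8n : ∀ n → root n * root n ≤ 9/8 * fromℕ n
root²≤9/8n zero             = ℚₚ.≤-refl
root²≤9/8n (suc zero)       = toWitness {a? = root 1 * root 1 ℚₚ.≤? 9/8 * fromℕ 1} _
root²≤9/8n (suc (suc zero)) = toWitness {a? = root 2 * root 2 ℚₚ.≤? 9/8 * fromℕ 2} _
root²≤9/8n (suc (suc (suc n))) = begin
  root (3 ℕ.+ n) * root (3 ℕ.+ n)                          ≡⟨ root²-suc (suc n) ⟩
  root (2 ℕ.+ n) * root (2 ℕ.+ n) + 1ℚ + w * w
    ≤⟨ ℚₚ.+-mono-≤ (ℚₚ.+-monoˡ-≤ 1ℚ (root²≤9/8n (suc (suc n)))) (rootStep²≤1/8 n) ⟩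
  9/8 * fromℕ (2 ℕ.+ n) + 1ℚ + 1/8                         ≡⟨ lem (fromℕ (2 ℕ.+ n)) ⟩
  9/8 * fromℕ (3 ℕ.+ n)                                    ∎
  where
  open ℚₚ.≤-Reasoning
  w = rootStep (suc (suc n))
  lem : ∀ p → 9/8 * p + 1ℚ + 1/8 ≡ 9/8 * (1ℚ + p)
  lem = solve-∀ ℚ-ring

-- True square roots would give the factor √2; the loss 9/8 turns it into 3/2. It matters that half
-- of it is below 1: this is the rate at which a random halving reduces the energy.
root-split : ∀ k l → root k + root l ≤ (+ 3 / 2) * root (k ℕ.+ l)
root-split k l = square-cancel-≤ (0≤p*q (toWitness {a? = 0ℚ ℚₚ.≤? + 3 / 2} _) (root-nonNeg (k ℕ.+ l))) (begin
  (a + b) * (a + b)                              ≤⟨ ≤-from-diff (lem₁ a b) (0≤p*p (a - b)) ⟩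
  (1ℚ + 1ℚ) * (a * a + b * b)                    ≤⟨ *-monoˡ (toWitness {a? = 0ℚ ℚₚ.≤? 1ℚ + 1ℚ} _) (ℚₚ.+-mono-≤ (root²≤9/8n k) (root²≤9/8n l)) ⟩
  (1ℚ + 1ℚ) * (9/8 * fromℕ k + 9/8 * fromℕ l)    ≡⟨ lem₂ (fromℕ k) (fromℕ l) ⟩
  (+ 9 / 4) * (fromℕ k + fromℕ l)                ≡⟨ cong ((+ 9 / 4) *_) (sym (fromℕ-+ k l)) ⟩
  (+ 9 / 4) * fromℕ (k ℕ.+ l)                    ≤⟨ *-monoˡ (toWitness {a? = 0ℚ ℚₚ.≤? + 9 / 4} _) (n≤root² (k ℕ.+ l)) ⟩
  (+ 9 / 4) * (r * r)                            ≡⟨ lem₃ r ⟩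
  ((+ 3 / 2) * r) * ((+ 3 / 2) * r)              ∎)
  where
  open ℚₚ.≤-Reasoning
  a = root k
  b = root l
  r = root (k ℕ.+ l)
  lem₁ : ∀ a b → (1ℚ + 1ℚ) * (a * a + b * b) ≡ (a + b) * (a + b) + (a - b) * (a - b)
  lem₁ = solve-∀ ℚ-ring
  lem₂ : ∀ a b → (1ℚ + 1ℚ) * (9/8 * a + 9/8 * b) ≡ (+ 9 / 4) * (a + b)
  lem₂ = solve-∀ ℚ-ring
  lem₃ : ∀ r → (+ 9 / 4) * (r * r) ≡ ((+ 3 / 2) * r) * ((+ 3 / 2) * r)
  lem₃ = solve-∀ ℚ-ring

-- Root times step is always ½ from index 1 on, and the root increases.
rootStep-antitone-suc : ∀ n → rootStep (suc n) ≤ rootStep n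
rootStep-antitone-suc zero    = toWitness {a? = rootStep 1 ℚₚ.≤? rootStep 0} _
rootStep-antitone-suc (suc n) = *-cancelˡ (root-pos n) (begin
  root (suc n) * w′               ≤⟨ *-mono (root-nonNeg (suc n)) r≤r′ (ℚₚ.<⇒≤ (rootStep-pos (suc (suc n)))) ℚₚ.≤-refl ⟩
  root (suc (suc n)) * w′         ≡⟨ root*rootStep (suc n) ⟩
  ½                               ≡⟨ sym (root*rootStep n) ⟩
  root (suc n) * rootStep (suc n) ∎)
  where
  open ℚₚ.≤-Reasoning
  w′ = rootStep (suc (suc n))
  r≤r′ : root (suc n) ≤ root (suc (suc n))
  r≤r′ = ≤-from-diff refl (ℚₚ.<⇒≤ (rootStep-pos (suc n)))

rootStep-antitone : ∀ n k → rootStep (n ℕ.+ k) ≤ rootStep n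
rootStep-antitone n zero    = ℚₚ.≤-reflexive (cong rootStep (ℕₚ.+-identityʳ n))
rootStep-antitone n (suc k) =
  subst (λ m → rootStep m ≤ rootStep n) (sym (ℕₚ.+-suc n k))
    (ℚₚ.≤-trans (rootStep-antitone-suc (n ℕ.+ k)) (rootStep-antitone n k))

root-mono : ∀ {m n} → m ℕ.≤ n → root m ≤ root n
root-mono {m} {n} m≤n = subst (λ k → root m ≤ root k) (ℕₚ.m+[n∸m]≡n m≤n) (go (n ℕ.∸ m))
  where
  go : ∀ k → root m ≤ root (m ℕ.+ k)
  go zero    = ℚₚ.≤-reflexive (cong root (sym (ℕₚ.+-identityʳ m)))
  go (suc k) = ℚₚ.≤-trans (go k) (subst (λ j → root (m ℕ.+ k) ≤ root j) (sym (ℕₚ.+-suc m k))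
                 (≤-from-diff (root-suc (m ℕ.+ k)) (ℚₚ.<⇒≤ (rootStep-pos (m ℕ.+ k)))))

root-concave : ∀ a p q → root (a ℕ.+ p ℕ.+ q) + root a ≤ root (a ℕ.+ p) + root (a ℕ.+ q)
root-concave a zero q = ℚₚ.≤-reflexive (trans (ℚₚ.+-comm (root (a ℕ.+ 0 ℕ.+ q)) (root a))
  (cong₂ (λ i j → root i + root (j ℕ.+ q)) (sym (ℕₚ.+-identityʳ a)) (ℕₚ.+-identityʳ a)))
root-concave a (suc p) q rewrite ℕₚ.+-suc a p | root-suc (a ℕ.+ p ℕ.+ q) | root-suc (a ℕ.+ p) =
  subst₂ _≤_ (lem (root (a ℕ.+ p ℕ.+ q)) (root a) _) (lem (root (a ℕ.+ p)) (root (a ℕ.+ q)) _) (ℚₚ.+-mono-≤ (root-concave a p q) (rootStep-antitone (a ℕ.+ p) q))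
  where
  lem : ∀ x y z → x + y + z ≡ x + z + y
  lem = solve-∀ ℚ-ring

-- Concavity in the form needed for repairs: `a` and `b` will be numbers of zeros after ∨ and ∧ of
-- two functions, `c` and `d` those of the functions themselves.
root-submodular : ∀ {a b c d} → a ℕ.≤ c → a ℕ.≤ d → a ℕ.+ b ≡ c ℕ.+ d → root a + root b ≤ root c + root d
root-submodular {a} {b} {c} {d} a≤c a≤d eq =
  subst₂ _≤_ (trans (ℚₚ.+-comm (root (a ℕ.+ (c ℕ.∸ a) ℕ.+ (d ℕ.∸ a))) (root a)) (cong (λ i → root a + root i) b≡))
    (cong₂ (λ i j → root i + root j) (ℕₚ.m+[n∸m]≡n a≤c) (ℕₚ.m+[n∸m]≡n a≤d))
    (root-concave a (c ℕ.∸ a) (d ℕ.∸ a))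
  where
  b≡ : a ℕ.+ (c ℕ.∸ a) ℕ.+ (d ℕ.∸ a) ≡ b
  b≡ = ℕₚ.+-cancelˡ-≡ a _ _ (begin
    a ℕ.+ (a ℕ.+ (c ℕ.∸ a) ℕ.+ (d ℕ.∸ a))  ≡⟨ cong (λ i → a ℕ.+ (i ℕ.+ (d ℕ.∸ a))) (ℕₚ.m+[n∸m]≡n a≤c) ⟩
    a ℕ.+ (c ℕ.+ (d ℕ.∸ a))                ≡⟨ ℕₚ.+-comm a _ ⟩
    c ℕ.+ (d ℕ.∸ a) ℕ.+ a                  ≡⟨ ℕₚ.+-assoc c _ a ⟩
    c ℕ.+ (d ℕ.∸ a ℕ.+ a)                  ≡⟨ cong (c ℕ.+_) (ℕₚ.m∸n+n≡m a≤d) ⟩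
    c ℕ.+ d                                ≡⟨ sym eq ⟩
    a ℕ.+ b                                ∎)
    where open ≡-Reasoning

-- Averages over the cube and Talagrand's inequality

avg : (Bool → ℚ) → ℚ
avg G = ½ * (G false + G true)

𝔼 : ∀ {d} → (Cube d → ℚ) → ℚ
𝔼 {zero}  F = F []
𝔼 {suc d} F = avg (λ b → 𝔼 (λ x → F (b ∷ x)))

avg-cong : ∀ {F G : Bool → ℚ} → (∀ b → F b ≡ G b) → avg F ≡ avg G
avg-cong F≡G = cong₂ (λ p q → ½ * (p + q)) (F≡G false) (F≡G true)

avg-mono : ∀ {F G : Bool → ℚ} → (∀ b → F b ≤ G b) → avg F ≤ avg G
avg-mono F≤G = *-monoˡ 0≤½ (ℚₚ.+-mono-≤ (F≤G false) (F≤G true))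

𝔼-cong : ∀ {d} {F G : Cube d → ℚ} → (∀ x → F x ≡ G x) → 𝔼 F ≡ 𝔼 G
𝔼-cong {zero}  F≡G = F≡G []
𝔼-cong {suc d} F≡G = avg-cong (λ b → 𝔼-cong (λ x → F≡G (b ∷ x)))

𝔼-mono : ∀ {d} {F G : Cube d → ℚ} → (∀ x → F x ≤ G x) → 𝔼 F ≤ 𝔼 G
𝔼-mono {zero}  F≤G = F≤G []
𝔼-mono {suc d} F≤G = avg-mono (λ b → 𝔼-mono (λ x → F≤G (b ∷ x)))

𝔼-+ : ∀ {d} (F G : Cube d → ℚ) → 𝔼 (λ x → F x + G x) ≡ 𝔼 F + 𝔼 G
𝔼-+ {zero}  F G = refl
𝔼-+ {suc d} F G = trans (avg-cong (λ b → 𝔼-+ (λ x → F (b ∷ x)) (λ x → G (b ∷ x))))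
  (lem (𝔼 (λ x → F (false ∷ x))) (𝔼 (λ x → F (true ∷ x))) (𝔼 (λ x → G (false ∷ x))) (𝔼 (λ x → G (true ∷ x))))
  where
  lem : ∀ a b c e → ½ * (a + c + (b + e)) ≡ ½ * (a + b) + ½ * (c + e)
  lem = solve-∀ ℚ-ring

𝔼-* : ∀ {d} c (F : Cube d → ℚ) → 𝔼 (λ x → c * F x) ≡ c * 𝔼 F
𝔼-* {zero}  c F = refl
𝔼-* {suc d} c F = trans (avg-cong (λ b → 𝔼-* c (λ x → F (b ∷ x))))
  (lem c (𝔼 (λ x → F (false ∷ x))) (𝔼 (λ x → F (true ∷ x))))
  where
  lem : ∀ c a b → ½ * (c * a + c * b) ≡ c * (½ * (a + b))
  lem = solve-∀ ℚ-ring

𝔼-- : ∀ {d} (F G : Cube d → ℚ) → 𝔼 (λ x → F x - G x) ≡ 𝔼 F - 𝔼 G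
𝔼-- F G = begin
  𝔼 (λ x → F x - G x)                 ≡⟨ 𝔼-cong (λ x → neg-as-* (F x) (G x)) ⟩
  𝔼 (λ x → F x + - 1ℚ * G x)          ≡⟨ 𝔼-+ F (λ x → - 1ℚ * G x) ⟩
  𝔼 F + 𝔼 (λ x → - 1ℚ * G x)          ≡⟨ cong (λ h → 𝔼 F + h) (𝔼-* (- 1ℚ) G) ⟩
  𝔼 F + - 1ℚ * 𝔼 G                    ≡⟨ sym (neg-as-* (𝔼 F) (𝔼 G)) ⟩
  𝔼 F - 𝔼 G                           ∎
  where
  open ≡-Reasoning
  neg-as-* : ∀ p q → p - q ≡ p + - 1ℚ * q
  neg-as-* = solve-∀ ℚ-ring

𝔼-const : ∀ d c → 𝔼 {d} (λ _ → c) ≡ c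
𝔼-const zero    c = refl
𝔼-const (suc d) c = trans (cong (λ h → ½ * (h + h)) (𝔼-const d c)) (lem c)
  where
  lem : ∀ c → ½ * (c + c) ≡ c
  lem = solve-∀ ℚ-ring

𝔼-nonNeg : ∀ {d} {F : Cube d → ℚ} → (∀ x → 0ℚ ≤ F x) → 0ℚ ≤ 𝔼 F
𝔼-nonNeg {d} {F} 0≤F = subst (_≤ 𝔼 F) (𝔼-const d 0ℚ) (𝔼-mono 0≤F)

𝔼-avg : ∀ {d} (G : Bool → Cube d → ℚ) → 𝔼 (λ x → avg (λ b → G b x)) ≡ avg (λ b → 𝔼 (G b))
𝔼-avg G = trans (𝔼-* ½ (λ x → G false x + G true x)) (cong (λ h → ½ * h) (𝔼-+ (G false) (G true)))

𝔼-swap : ∀ {d e} (F : Cube d → Cube e → ℚ) → 𝔼 (λ x → 𝔼 (λ y → F x y)) ≡ 𝔼 (λ y → 𝔼 (λ x → F x y))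
𝔼-swap {zero}  F = refl
𝔼-swap {suc d} F = trans (avg-cong (λ b → 𝔼-swap (λ x y → F (b ∷ x) y))) (sym (𝔼-avg (λ b y → 𝔼 (λ x → F (b ∷ x) y))))

𝔼-not : ∀ {d} (F : Cube d → ℚ) → 𝔼 (λ x → F (Vec.map not x)) ≡ 𝔼 F
𝔼-not {zero}  F = refl
𝔼-not {suc d} F = trans (avg-cong (λ b → 𝔼-not (λ x → F (not b ∷ x))))
  (cong (λ h → ½ * h) (ℚₚ.+-comm (𝔼 (λ x → F (true ∷ x))) (𝔼 (λ x → F (false ∷ x)))))

-- The first-moment method, by which all random choices are fixed later on.
𝔼-attained : ∀ {d} (F : Cube d → ℚ) → ∃ λ x → F x ≤ 𝔼 F
𝔼-attained {zero}  F = [] , ℚₚ.≤-refl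
𝔼-attained {suc d} F with 𝔼-attained (λ x → F (false ∷ x)) | 𝔼-attained (λ x → F (true ∷ x))
... | x , Fx≤ | y , Fy≤ = choose (ℚₚ.≤-total p q)
  where
  p = 𝔼 (λ x → F (false ∷ x))
  q = 𝔼 (λ x → F (true ∷ x))
  lem₀ : ∀ p q → ½ * (p + q) ≡ p + ½ * (q - p)
  lem₀ = solve-∀ ℚ-ring
  lem₁ : ∀ p q → ½ * (p + q) ≡ q + ½ * (p - q)
  lem₁ = solve-∀ ℚ-ring
  choose : p ≤ q ⊎ q ≤ p → ∃ λ x → F x ≤ 𝔼 F
  choose (inj₁ p≤q) = false ∷ x , ℚₚ.≤-trans Fx≤ (≤-from-diff (lem₀ p q) (0≤p*q 0≤½ (p≤q⇒0≤q-p p≤q)))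
  choose (inj₂ q≤p) = true ∷ y , ℚₚ.≤-trans Fy≤ (≤-from-diff (lem₁ p q) (0≤p*q 0≤½ (p≤q⇒0≤q-p q≤p)))

ι : Bool → ℚ
ι false = 0ℚ
ι true  = 1ℚ

ι-nonNeg : ∀ b → 0ℚ ≤ ι b
ι-nonNeg false = ℚₚ.≤-refl
ι-nonNeg true  = 0≤1ℚ

ι≤1 : ∀ b → ι b ≤ 1ℚ
ι≤1 false = 0≤1ℚ
ι≤1 true  = ℚₚ.≤-refl

isZero : Bool → ℕ
isZero false = 1
isZero true  = 0

μ : ∀ {d} → (Cube d → Bool) → ℚ
μ A = 𝔼 (λ x → ι (A x))

μ-nonNeg : ∀ {d} (A : Cube d → Bool) → 0ℚ ≤ μ A
μ-nonNeg A = 𝔼-nonNeg (λ x → ι-nonNeg (A x))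

μ≤1 : ∀ {d} (A : Cube d → Bool) → μ A ≤ 1ℚ
μ≤1 {d} A = subst (μ A ≤_) (𝔼-const d 1ℚ) (𝔼-mono (λ x → ι≤1 (A x)))

-- The number of neighbours of the point outside A. The value of A at the point itself is not
-- consulted; all uses are restricted to points of A.
sens : ∀ {d} → (Cube d → Bool) → Cube d → ℕ
sens A []      = 0
sens A (b ∷ x) = isZero (A (not b ∷ x)) ℕ.+ sens (λ y → A (b ∷ y)) x

var : ℚ → ℚ
var p = p * (1ℚ - p)

4ℚ : ℚ
4ℚ = fromℕ 4

Talagrand : ℕ → Set
Talagrand d = ∀ (A : Cube d → Bool) (r : Cube d → ℚ) (α : ℚ) → 0ℚ ≤ α →
  (∀ x → A x ≡ true → 0ℚ ≤ r x × α * α * fromℕ (sens A x) ≤ r x * r x) →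
  α * var (μ A) ≤ 𝔼 (λ x → ι (A x) * r x)

-- The slope with which 1_{x ∉ B} is traded against √(sens A) is a rational point
-- ((4 - δ²)/(4 + δ²), 4δ/(4 + δ²)) of the unit circle, cleared of denominators.
talagrand-half : ∀ {d} → Talagrand d → ∀ (A B : Cube d → Bool) (r : Cube d → ℚ) (α : ℚ) → 0ℚ ≤ α → μ B ≤ μ A →
  (∀ x → A x ≡ true → 0ℚ ≤ r x × α * α * fromℕ (isZero (B x) ℕ.+ sens A x) ≤ r x * r x) →
  α * (var (μ A) + ½ * ((μ A - μ B) * (μ A - μ B))) ≤ 𝔼 (λ x → ι (A x) * r x)
talagrand-half {d} ih A B r α 0≤α b≤a hyp = *-cancelˡ 0<k (begin
  k * (α * (var a + ½ * (δ * δ)))            ≤⟨ ≤-from-diff (numeric a δ α) 0≤gap ⟩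
  (l * α) * var a + m * δ                    ≤⟨ ℚₚ.+-mono-≤ (ih A r′ (l * α) (0≤p*q 0≤l 0≤α) hyp′) (*-monoˡ 0≤m δ≤) ⟩
  𝔼 (λ x → ι (A x) * r′ x) + m * 𝔼 (λ x → ι (A x) * e x)
    ≡⟨ cong (λ h → 𝔼 (λ x → ι (A x) * r′ x) + h) (sym (𝔼-* m (λ x → ι (A x) * e x))) ⟩
  𝔼 (λ x → ι (A x) * r′ x) + 𝔼 (λ x → m * (ι (A x) * e x))
    ≡⟨ sym (𝔼-+ (λ x → ι (A x) * r′ x) (λ x → m * (ι (A x) * e x))) ⟩
  𝔼 (λ x → ι (A x) * r′ x + m * (ι (A x) * e x))
    ≡⟨ 𝔼-cong (λ x → collect (ι (A x)) k (r x) m (e x)) ⟩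
  𝔼 (λ x → k * (ι (A x) * r x))              ≡⟨ 𝔼-* k (λ x → ι (A x) * r x) ⟩
  k * 𝔼 (λ x → ι (A x) * r x)                ∎)
  where
  open ℚₚ.≤-Reasoning
  a = μ A
  b = μ B
  δ = a - b
  k = 4ℚ + δ * δ
  l = 4ℚ - δ * δ
  m = 4ℚ * δ * α
  e : Cube d → ℚ
  e x = fromℕ (isZero (B x))
  r′ : Cube d → ℚ
  r′ x = k * r x - m * e x
  0≤δ : 0ℚ ≤ δ
  0≤δ = p≤q⇒0≤q-p b≤a
  δ≤1 : 0ℚ ≤ 1ℚ - δ
  δ≤1 = subst (0ℚ ≤_) (lem a b) (0≤p+q (p≤q⇒0≤q-p (μ≤1 A)) (μ-nonNeg B))
    where
    lem : ∀ a b → 1ℚ - a + b ≡ 1ℚ - (a - b)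
    lem = solve-∀ ℚ-ring
  0≤1-δ² : 0ℚ ≤ 1ℚ - δ * δ
  0≤1-δ² = subst (0ℚ ≤_) (lem δ) (0≤p*q δ≤1 (0≤p+q 0≤1ℚ 0≤δ))
    where
    lem : ∀ δ → (1ℚ - δ) * (1ℚ + δ) ≡ 1ℚ - δ * δ
    lem = solve-∀ ℚ-ring
  0≤l : 0ℚ ≤ l
  0≤l = subst (0ℚ ≤_) (lem (δ * δ)) (0≤p+q (fromℕ-nonNeg 3) 0≤1-δ²)
    where
    lem : ∀ p → fromℕ 3 + (1ℚ - p) ≡ 4ℚ - p
    lem = solve-∀ ℚ-ring
  0<k : 0ℚ < k
  0<k = ℚₚ.<-≤-trans (toWitness {a? = 0ℚ ℚₚ.<? 4ℚ} _) (≤-from-diff refl (0≤p*p δ))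
  0≤m : 0ℚ ≤ m
  0≤m = 0≤p*q (0≤p*q (fromℕ-nonNeg 4) 0≤δ) 0≤α
  collect : ∀ i k r m e → i * (k * r - m * e) + m * (i * e) ≡ k * (i * r)
  collect = solve-∀ ℚ-ring
  -- The part of A outside B has measure at least `μ A - μ B`.
  δ≤ : δ ≤ 𝔼 (λ x → ι (A x) * e x)
  δ≤ = subst (_≤ 𝔼 (λ x → ι (A x) * e x)) (𝔼-- (λ x → ι (A x)) (λ x → ι (B x))) (𝔼-mono (λ x → pointwise (A x) (B x)))
    where
    pointwise : ∀ p q → ι p - ι q ≤ ι p * fromℕ (isZero q)
    pointwise false false = toWitness {a? = _ ℚₚ.≤? _} _
    pointwise false true  = toWitness {a? = _ ℚₚ.≤? _} _
    pointwise true  false = toWitness {a? = _ ℚₚ.≤? _} _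
    pointwise true  true  = toWitness {a? = _ ℚₚ.≤? _} _
  -- The slack of the numerical inequality, written as a visibly nonnegative expression.
  gap : ℚ
  gap = α * ((δ * δ) * (1ℚ + (1ℚ + 1ℚ) * ((a - ½) * (a - ½)) + ½ * (1ℚ - δ * δ)))
  0≤gap : 0ℚ ≤ gap
  0≤gap = 0≤p*q 0≤α (0≤p*q (0≤p*p δ) (0≤p+q (0≤p+q 0≤1ℚ (0≤p*q (fromℕ-nonNeg 2) (0≤p*p (a - ½)))) (0≤p*q 0≤½ 0≤1-δ²)))
  numeric : ∀ a δ α → (4ℚ - δ * δ) * α * (a * (1ℚ - a)) + 4ℚ * δ * α * δ
    ≡ (4ℚ + δ * δ) * (α * (a * (1ℚ - a) + ½ * (δ * δ))) + α * ((δ * δ) * (1ℚ + (1ℚ + 1ℚ) * ((a - ½) * (a - ½)) + ½ * (1ℚ - δ * δ)))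
  numeric = solve-∀ ℚ-ring
  hyp′ : ∀ x → A x ≡ true → 0ℚ ≤ r′ x × (l * α) * (l * α) * fromℕ (sens A x) ≤ r′ x * r′ x
  hyp′ x Ax with B x | hyp x Ax
  -- Over a point of B nothing is subtracted, and `l ≤ k` is enough.
  ... | true  | 0≤r , α²n≤r² = subst (0ℚ ≤_) (lem₁ k (r x) m) (0≤p*q (ℚₚ.<⇒≤ 0<k) 0≤r) , (begin
      (l * α) * (l * α) * n                     ≡⟨ lem₂ l α n ⟩
      (l * l) * (α * α * n)                     ≤⟨ *-mono (0≤p*p l) (*-mono 0≤l l≤k 0≤l l≤k) (0≤p*q (0≤p*p α) (fromℕ-nonNeg (sens A x))) α²n≤r² ⟩
      (k * k) * (r x * r x)                     ≡⟨ lem₃ k (r x) m ⟩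
      (k * r x - m * 0ℚ) * (k * r x - m * 0ℚ)   ∎)
    where
    n = fromℕ (sens A x)
    lem₁ : ∀ k r m → k * r ≡ k * r - m * 0ℚ
    lem₁ = solve-∀ ℚ-ring
    lem₂ : ∀ l α n → (l * α) * (l * α) * n ≡ (l * l) * (α * α * n)
    lem₂ = solve-∀ ℚ-ring
    lem₃ : ∀ k r m → (k * k) * (r * r) ≡ (k * r - m * 0ℚ) * (k * r - m * 0ℚ)
    lem₃ = solve-∀ ℚ-ring
    l≤k : l ≤ k
    l≤k = ≤-from-diff (lem δ) (0≤p+q (0≤p*p δ) (0≤p*p δ))
      where
      lem : ∀ δ → 4ℚ + δ * δ ≡ 4ℚ - δ * δ + (δ * δ + δ * δ)
      lem = solve-∀ ℚ-ring
  ... | false | 0≤r , α²n≤r² = subst (0ℚ ≤_) (lem₁ (r x) δ α) 0≤split , ≤-from-diff (lem₂ δ (r x) α n) 0≤split₂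
    where
    -- Over a point outside B the edge between the halves is counted, so `α ≤ r x`; with
    -- `k - 4δ = 4(1 - δ) + δ²` this keeps `r′` nonnegative.
    n = fromℕ (sens A x)
    α≤r : α ≤ r x
    α≤r = square-cancel-≤ 0≤r (ℚₚ.≤-trans (≤-from-diff (lem α n) (0≤p*q (0≤p*p α) (fromℕ-nonNeg (sens A x)))) α²n≤r²)
      where
      lem : ∀ α n → α * α * (1ℚ + n) ≡ α * α + α * α * n
      lem = solve-∀ ℚ-ring
    0≤split : 0ℚ ≤ k * (r x - α) + (4ℚ * (1ℚ - δ) + δ * δ) * α
    0≤split = 0≤p+q (0≤p*q (ℚₚ.<⇒≤ 0<k) (p≤q⇒0≤q-p α≤r))
      (0≤p*q (0≤p+q (0≤p*q (fromℕ-nonNeg 4) δ≤1) (0≤p*p δ)) 0≤α)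
    lem₁ : ∀ r δ α → (4ℚ + δ * δ) * (r - α) + (4ℚ * (1ℚ - δ) + δ * δ) * α ≡ (4ℚ + δ * δ) * r - 4ℚ * δ * α * 1ℚ
    lem₁ = solve-∀ ℚ-ring
    -- Since `k² - (4δ)² = l²`, the squares of `k r - 4δα` and `4δ r - k α` differ by
    -- `l² (r² - α²)`.
    w = 4ℚ * δ * r x - k * α
    0≤split₂ : 0ℚ ≤ w * w + l * l * (r x * r x - α * α * (1ℚ + n))
    0≤split₂ = 0≤p+q (0≤p*p w) (0≤p*q (0≤p*p l) (p≤q⇒0≤q-p α²n≤r²))
    lem₂ : ∀ δ r α n → ((4ℚ + δ * δ) * r - 4ℚ * δ * α * 1ℚ) * ((4ℚ + δ * δ) * r - 4ℚ * δ * α * 1ℚ)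
      ≡ ((4ℚ - δ * δ) * α) * ((4ℚ - δ * δ) * α) * n
        + ((4ℚ * δ * r - (4ℚ + δ * δ) * α) * (4ℚ * δ * r - (4ℚ + δ * δ) * α) + (4ℚ - δ * δ) * (4ℚ - δ * δ) * (r * r - α * α * (1ℚ + n)))
    lem₂ = solve-∀ ℚ-ring

-- Edges between the two halves are exploited only in the half of larger measure and dropped in the
-- other. The gain `½ (p - q)²` is exactly what is required, because the variance at `½ (p + q)`
-- exceeds the average of the variances by `¼ (p - q)²`.
talagrand : ∀ d → Talagrand d
talagrand zero A r α 0≤α hyp with A [] | hyp []
... | false | _ = ℚₚ.≤-reflexive (lem α (r []))
  where
  lem : ∀ α r → α * (0ℚ * (1ℚ - 0ℚ)) ≡ 0ℚ * r
  lem = solve-∀ ℚ-ring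
... | true  | h = subst₂ _≤_ (sym (lem α)) (sym (ℚₚ.*-identityˡ (r []))) (proj₁ (h refl))
  where
  lem : ∀ α → α * (1ℚ * (1ℚ - 1ℚ)) ≡ 0ℚ
  lem = solve-∀ ℚ-ring
talagrand (suc d) A r α 0≤α hyp = split (ℚₚ.≤-total a₁ a₀)
  where
  A₀ A₁ : Cube d → Bool
  A₀ x = A (false ∷ x)
  A₁ x = A (true ∷ x)
  a₀ = μ A₀
  a₁ = μ A₁
  restrict : ∀ b x → A (b ∷ x) ≡ true → 0ℚ ≤ r (b ∷ x) × α * α * fromℕ (sens (λ y → A (b ∷ y)) x) ≤ r (b ∷ x) * r (b ∷ x)
  restrict b x Abx = proj₁ (hyp (b ∷ x) Abx) ,
    ℚₚ.≤-trans (*-monoˡ (0≤p*p α) (fromℕ-mono (ℕₚ.m≤n+m _ (isZero (A (not b ∷ x)))))) (proj₂ (hyp (b ∷ x) Abx))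
  sub : ∀ b → α * var (μ (λ x → A (b ∷ x))) ≤ 𝔼 (λ x → ι (A (b ∷ x)) * r (b ∷ x))
  sub b = talagrand d (λ x → A (b ∷ x)) (λ x → r (b ∷ x)) α 0≤α (restrict b)
  half : ∀ b → μ (λ x → A (not b ∷ x)) ≤ μ (λ x → A (b ∷ x)) → _
  half b = λ le → talagrand-half (talagrand d) (λ x → A (b ∷ x)) (λ x → A (not b ∷ x)) (λ x → r (b ∷ x)) α 0≤α le (λ x → hyp (b ∷ x))
  combine₀ : ∀ α p q → ½ * (α * (p * (1ℚ - p) + ½ * ((p - q) * (p - q))) + α * (q * (1ℚ - q))) ≡ α * (½ * (p + q) * (1ℚ - ½ * (p + q)))
  combine₀ = solve-∀ ℚ-ring
  combine₁ : ∀ α p q → ½ * (α * (p * (1ℚ - p)) + α * (q * (1ℚ - q) + ½ * ((q - p) * (q - p)))) ≡ α * (½ * (p + q) * (1ℚ - ½ * (p + q)))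
  combine₁ = solve-∀ ℚ-ring
  split : a₁ ≤ a₀ ⊎ a₀ ≤ a₁ → α * var (μ A) ≤ 𝔼 (λ x → ι (A x) * r x)
  split (inj₁ le) = subst (_≤ 𝔼 (λ x → ι (A x) * r x)) (combine₀ α a₀ a₁) (*-monoˡ 0≤½ (ℚₚ.+-mono-≤ (half false le) (sub true)))
  split (inj₂ le) = subst (_≤ 𝔼 (λ x → ι (A x) * r x)) (combine₁ α a₀ a₁) (*-monoˡ 0≤½ (ℚₚ.+-mono-≤ (sub false) (half true le)))

talagrand-root : ∀ {d} (A : Cube d → Bool) → var (μ A) ≤ 𝔼 (λ x → ι (A x) * root (sens A x))
talagrand-root {d} A = subst (_≤ 𝔼 (λ x → ι (A x) * root (sens A x))) (ℚₚ.*-identityˡ (var (μ A)))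
  (talagrand d A (λ x → root (sens A x)) 1ℚ 0≤1ℚ
    (λ x _ → root-nonNeg (sens A x) , subst (_≤ root (sens A x) * root (sens A x)) (sym (lem (fromℕ (sens A x)))) (n≤root² (sens A x))))
  where
  lem : ∀ n → 1ℚ * 1ℚ * n ≡ n
  lem = solve-∀ ℚ-ring

-- Random repairs

all-Bool? : {P : Bool → Set} → (∀ b → Dec (P b)) → Dec (∀ b → P b)
all-Bool? P? with P? false | P? true
... | yes pf | yes pt = yes λ { false → pf ; true → pt }
... | no ¬pf | _      = no λ p → ¬pf (p false)
... | yes _  | no ¬pt = no λ p → ¬pt (p true)

pick : Bool → Bool → Bool → Bool → Bool → Bool
pick false false z     a b = a
pick false true  z     a b = b
pick true  false false a b = a
pick true  false true  a b = a ∧ b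
pick true  true  false a b = a ∨ b
pick true  true  true  a b = b

-- In every direction i ∈ S, in increasing order of i, repair the violated pairs
-- (1 , 0) to (1 , 1) when z_i = 0 and to (0 , 0) when z_i = 1.
repair : ∀ {d} → Cube d → Cube d → (Cube d → Bool) → Cube d → Bool
repair []      []       f []       = f []
repair (s ∷ S) (z ∷ zs) f (x ∷ xs) = repair S zs (λ w → pick s x z (f (false ∷ w)) (f (true ∷ w))) xs

_⊑_ : ∀ {d} → (Cube d → Bool) → (Cube d → Bool) → Set
f ⊑ g = ∀ x → f x B.≤ g x

MonotoneIn : ∀ {d} → Cube d → (Cube d → Bool) → Set
MonotoneIn []      f = ⊤
MonotoneIn (u ∷ U) f = (u ≡ true → (λ w → f (false ∷ w)) ⊑ (λ w → f (true ∷ w))) × (∀ b → MonotoneIn U (λ w → f (b ∷ w)))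

pick-mono : ∀ s x z {a b a′ b′} → a B.≤ a′ → b B.≤ b′ → pick s x z a b B.≤ pick s x z a′ b′
pick-mono false false z     p q = p
pick-mono false true  z     p q = q
pick-mono true  false false p q = p
pick-mono true  false true  {a} {b} {a′} {b′} p q = ∧-mono p q
  where
  ∧-mono : ∀ {a b a′ b′} → a B.≤ a′ → b B.≤ b′ → (a ∧ b) B.≤ (a′ ∧ b′)
  ∧-mono {false} _ _ = Boolₚ.≤-minimum _
  ∧-mono {true} B.b≤b q = q
pick-mono true  true  false {a} {b} {a′} {b′} p q = ∨-mono p q
  where
  ∨-mono : ∀ {a b a′ b′} → a B.≤ a′ → b B.≤ b′ → (a ∨ b) B.≤ (a′ ∨ b′)
  ∨-mono {a′ = true} _ _ = Boolₚ.≤-maximum _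
  ∨-mono {a′ = false} B.b≤b q = q
pick-mono true  true  true  p q = q

pick-increasing : ∀ z a b → pick true false z a b B.≤ pick true true z a b
pick-increasing = toWitness {a? = all-Bool? λ z → all-Bool? λ a → all-Bool? λ b → pick true false z a b Boolₚ.≤? pick true true z a b} _

repair-mono : ∀ {d} (S z : Cube d) {f g} → f ⊑ g → repair S z f ⊑ repair S z g
repair-mono []      []       f⊑g []       = f⊑g []
repair-mono (s ∷ S) (z ∷ zs) f⊑g (x ∷ xs) =
  repair-mono S zs (λ w → pick-mono s x z (f⊑g (false ∷ w)) (f⊑g (true ∷ w))) xs

MonotoneIn-pick : ∀ {d} (V : Cube d) s x z {f g} → MonotoneIn V f → MonotoneIn V g → MonotoneIn V (λ w → pick s x z (f w) (g w))
MonotoneIn-pick []      s x z _ _ = tt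
MonotoneIn-pick (v ∷ V) s x z (f₀₁ , fs) (g₀₁ , gs) =
  (λ v≡true w → pick-mono s x z (f₀₁ v≡true w) (g₀₁ v≡true w)) ,
  (λ b → MonotoneIn-pick V s x z (fs b) (gs b))

-- Repairing a pair is a monotone operation on its two values, so the order between parallel faces
-- survives. Thus later repairs do not destroy what earlier ones achieved.
repair-preserves : ∀ {d} (V S z : Cube d) {f} → MonotoneIn V f → MonotoneIn V (repair S z f)
repair-preserves []      []      []       _ = tt
repair-preserves (v ∷ V) (s ∷ S) (z ∷ zs) {f} (f₀₁ , fs) =
  (λ v≡true → repair-mono S zs (λ w → first s (f₀₁ v≡true w))) ,
  (λ b → repair-preserves V S zs (MonotoneIn-pick V s b z (fs false) (fs true)))
  where
  first : ∀ s {a b} → a B.≤ b → pick s false z a b B.≤ pick s true z a b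
  first false a≤b = a≤b
  first true {a} {b} _ = pick-increasing z a b

repair-monotone : ∀ {d} (S z : Cube d) f → MonotoneIn S (repair S z f)
repair-monotone []      []       f = tt
repair-monotone (s ∷ S) (z ∷ zs) f =
  (λ { refl → repair-mono S zs (λ w → pick-increasing z (f (false ∷ w)) (f (true ∷ w))) }) ,
  (λ b → repair-monotone S zs (λ w → pick s b z (f (false ∷ w)) (f (true ∷ w))))

repair-id : ∀ {d} (S z : Cube d) {f} → MonotoneIn S f → ∀ x → repair S z f x ≡ f x
repair-id []      []       _          []       = refl
repair-id (s ∷ S) (z ∷ zs) {f} (f₀₁ , fs) (x ∷ xs) =
  trans (repair-id S zs (MonotoneIn-pick S s x z (fs false) (fs true)) xs) (last s x z f₀₁)
  where
  absorb-∧ : ∀ {a b} → a B.≤ b → a ∧ b ≡ a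
  absorb-∧ {false} _ = refl
  absorb-∧ {true} B.b≤b = refl
  absorb-∨ : ∀ {a b} → a B.≤ b → a ∨ b ≡ b
  absorb-∨ {false} _ = refl
  absorb-∨ {true} B.b≤b = refl
  last : ∀ s x z → (s ≡ true → (λ w → f (false ∷ w)) ⊑ (λ w → f (true ∷ w))) →
    pick s x z (f (false ∷ xs)) (f (true ∷ xs)) ≡ f (x ∷ xs)
  last false false z     _   = refl
  last false true  z     _   = refl
  last true  false false _   = refl
  last true  false true  f₀₁ = absorb-∧ (f₀₁ refl xs)
  last true  true  false f₀₁ = absorb-∨ (f₀₁ refl xs)
  last true  true  true  _   = refl

-- Distances, and contraction under random repairs

neq : Bool → Bool → ℚ
neq a b = ι (a xor b)

dist : ∀ {d} → (Cube d → Bool) → (Cube d → Bool) → ℚ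
dist f g = 𝔼 (λ x → neq (f x) (g x))

neq-triangle : ∀ a b c → neq a c ≤ neq a b + neq b c
neq-triangle = toWitness {a? = all-Bool? λ a → all-Bool? λ b → all-Bool? λ c → neq a c ℚₚ.≤? neq a b + neq b c} _

neq-sym : ∀ a b → neq a b ≡ neq b a
neq-sym = toWitness {a? = all-Bool? λ a → all-Bool? λ b → neq a b ℚₚ.≟ neq b a} _

dist-refl : ∀ {d} (f : Cube d → Bool) → dist f f ≡ 0ℚ
dist-refl {d} f = trans (𝔼-cong (λ x → neq-refl (f x))) (𝔼-const d 0ℚ)
  where
  neq-refl : ∀ b → neq b b ≡ 0ℚ
  neq-refl false = refl
  neq-refl true  = refl

dist-triangle : ∀ {d} (f g h : Cube d → Bool) → dist f h ≤ dist f g + dist g h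
dist-triangle f g h = ℚₚ.≤-trans (𝔼-mono (λ x → neq-triangle (f x) (g x) (h x)))
  (ℚₚ.≤-reflexive (𝔼-+ (λ x → neq (f x) (g x)) (λ x → neq (g x) (h x))))

dist-sym : ∀ {d} (f g : Cube d → Bool) → dist f g ≡ dist g f
dist-sym f g = 𝔼-cong (λ x → neq-sym (f x) (g x))

dist-cong : ∀ {d} {f f′ g g′ : Cube d → Bool} → (∀ x → f x ≡ f′ x) → (∀ x → g x ≡ g′ x) → dist f g ≡ dist f′ g′
dist-cong f≡ g≡ = 𝔼-cong (λ x → cong₂ neq (f≡ x) (g≡ x))

-- The average over z is essential: for a fixed z, the pairs (1 , 0) and (0 , 0) differ in one place
-- but may be repaired to (1 , 1) and (0 , 0). For the other z they then coincide.
pick-contraction : ∀ s a b a′ b′ →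
  avg (λ z → avg (λ x → neq (pick s x z a b) (pick s x z a′ b′))) ≤ avg (λ x → neq (if x then b else a) (if x then b′ else a′))
pick-contraction = toWitness {a? = all-Bool? λ s → all-Bool? λ a → all-Bool? λ b → all-Bool? λ a′ → all-Bool? λ b′ →
  avg (λ z → avg (λ x → neq (pick s x z a b) (pick s x z a′ b′))) ℚₚ.≤? avg (λ x → neq (if x then b else a) (if x then b′ else a′))} _

repair-contraction : ∀ {d} (S : Cube d) (f g : Cube d → Bool) → 𝔼 (λ z → dist (repair S z f) (repair S z g)) ≤ dist f g
repair-contraction []      f g = ℚₚ.≤-refl
repair-contraction {suc d} (s ∷ S) f g = begin
  avg (λ z → 𝔼 (λ zs → avg (λ x → D z x zs)))               ≡⟨ avg-cong (λ z → 𝔼-avg (D z)) ⟩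
  avg (λ z → avg (λ x → 𝔼 (D z x)))                         ≤⟨ avg-mono (λ z → avg-mono (λ x → repair-contraction S (g₀ f z x) (g₀ g z x))) ⟩
  avg (λ z → avg (λ x → 𝔼 (λ w → N z x w)))                 ≡⟨ avg-cong (λ z → sym (𝔼-avg (N z))) ⟩
  avg (λ z → 𝔼 (λ w → avg (λ x → N z x w)))                 ≡⟨ sym (𝔼-avg (λ z w → avg (λ x → N z x w))) ⟩
  𝔼 (λ w → avg (λ z → avg (λ x → N z x w)))
    ≤⟨ 𝔼-mono (λ w → pick-contraction s (f (false ∷ w)) (f (true ∷ w)) (g (false ∷ w)) (g (true ∷ w))) ⟩
  𝔼 (λ w → avg (λ x → neq (if x then f (true ∷ w) else f (false ∷ w)) (if x then g (true ∷ w) else g (false ∷ w))))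
    ≡⟨ 𝔼-avg (λ x w → neq (if x then f (true ∷ w) else f (false ∷ w)) (if x then g (true ∷ w) else g (false ∷ w))) ⟩
  dist f g                                                  ∎
  where
  open ℚₚ.≤-Reasoning
  g₀ : (Cube (suc d) → Bool) → Bool → Bool → Cube d → Bool
  g₀ f z x w = pick s x z (f (false ∷ w)) (f (true ∷ w))
  D : Bool → Bool → Cube d → ℚ
  D z x zs = dist (repair S zs (g₀ f z x)) (repair S zs (g₀ g z x))
  N : Bool → Bool → Cube d → ℚ
  N z x w = neq (g₀ f z x w) (g₀ g z x w)

-- Zeros among the neighbours, and the sensitivity of repairs

zeros : ∀ {k} → (Fin k → Bool) → ℕ
zeros {zero}  e = 0
zeros {suc k} e = isZero (e zero) ℕ.+ zeros (λ j → e (suc j))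

upZero : Bool → Bool → Bool → ℕ
upZero true false v = isZero v
upZero _    _     v = 0

-- For f x = 1 this is the number of violated edges of f leaving x in a direction of U.
outZeros : ∀ {d} → Cube d → (Cube d → Bool) → Cube d → ℕ
outZeros []      f []       = 0
outZeros (u ∷ U) f (x ∷ xs) = upZero u x (f (true ∷ xs)) ℕ.+ outZeros U (λ w → f (x ∷ w)) xs

_∩_ : ∀ {d} → Cube d → Cube d → Cube d
_∩_ = zipWith _∧_

+-interchange : ∀ a b c e → (a ℕ.+ b) ℕ.+ (c ℕ.+ e) ≡ (a ℕ.+ c) ℕ.+ (b ℕ.+ e)
+-interchange = ℕ-RingSolver.solve-∀

-- Summed over neighbours, this and `isZero-∨ˡ`, `isZero-∨ʳ` yield the hypotheses of
-- `root-submodular`.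
isZero-modular : ∀ a b → isZero (a ∨ b) ℕ.+ isZero (a ∧ b) ≡ isZero a ℕ.+ isZero b
isZero-modular false false = refl
isZero-modular false true  = refl
isZero-modular true  false = refl
isZero-modular true  true  = refl

isZero-∨ˡ : ∀ a b → isZero (a ∨ b) ℕ.≤ isZero a
isZero-∨ˡ false false = s≤s z≤n
isZero-∨ˡ false true  = z≤n
isZero-∨ˡ true  b     = z≤n

isZero-∨ʳ : ∀ a b → isZero (a ∨ b) ℕ.≤ isZero b
isZero-∨ʳ false b = ℕₚ.≤-refl
isZero-∨ʳ true  b = z≤n

zeros-modular : ∀ {k} (e e′ : Fin k → Bool) → zeros (λ j → e j ∨ e′ j) ℕ.+ zeros (λ j → e j ∧ e′ j) ≡ zeros e ℕ.+ zeros e′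
zeros-modular {zero}  e e′ = refl
zeros-modular {suc k} e e′ = trans (+-interchange (isZero (e zero ∨ e′ zero)) _ _ _)
  (trans (cong₂ ℕ._+_ (isZero-modular (e zero) (e′ zero)) (zeros-modular (λ j → e (suc j)) (λ j → e′ (suc j))))
    (+-interchange (isZero (e zero)) _ _ _))

zeros-∨ˡ : ∀ {k} (e e′ : Fin k → Bool) → zeros (λ j → e j ∨ e′ j) ℕ.≤ zeros e
zeros-∨ˡ {zero}  e e′ = z≤n
zeros-∨ˡ {suc k} e e′ = ℕₚ.+-mono-≤ (isZero-∨ˡ (e zero) (e′ zero)) (zeros-∨ˡ (λ j → e (suc j)) (λ j → e′ (suc j)))

zeros-∨ʳ : ∀ {k} (e e′ : Fin k → Bool) → zeros (λ j → e j ∨ e′ j) ℕ.≤ zeros e′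
zeros-∨ʳ {zero}  e e′ = z≤n
zeros-∨ʳ {suc k} e e′ = ℕₚ.+-mono-≤ (isZero-∨ʳ (e zero) (e′ zero)) (zeros-∨ʳ (λ j → e (suc j)) (λ j → e′ (suc j)))

upZero-modular : ∀ u x a b → upZero u x (a ∨ b) ℕ.+ upZero u x (a ∧ b) ≡ upZero u x a ℕ.+ upZero u x b
upZero-modular false x     a b = refl
upZero-modular true  false a b = isZero-modular a b
upZero-modular true  true  a b = refl

upZero-∨ˡ : ∀ u x a b → upZero u x (a ∨ b) ℕ.≤ upZero u x a
upZero-∨ˡ false x     a b = z≤n
upZero-∨ˡ true  false a b = isZero-∨ˡ a b
upZero-∨ˡ true  true  a b = z≤n

upZero-∨ʳ : ∀ u x a b → upZero u x (a ∨ b) ℕ.≤ upZero u x b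
upZero-∨ʳ false x     a b = z≤n
upZero-∨ʳ true  false a b = isZero-∨ʳ a b
upZero-∨ʳ true  true  a b = z≤n

outZeros-modular : ∀ {d} (U : Cube d) (f g : Cube d → Bool) (x : Cube d) →
  outZeros U (λ w → f w ∨ g w) x ℕ.+ outZeros U (λ w → f w ∧ g w) x ≡ outZeros U f x ℕ.+ outZeros U g x
outZeros-modular []      f g []       = refl
outZeros-modular (u ∷ U) f g (x ∷ xs) = trans (+-interchange (upZero u x _) _ _ _)
  (trans (cong₂ ℕ._+_ (upZero-modular u x (f (true ∷ xs)) (g (true ∷ xs))) (outZeros-modular U (λ w → f (x ∷ w)) (λ w → g (x ∷ w)) xs))
    (+-interchange (upZero u x (f (true ∷ xs))) _ _ _))

outZeros-∨ˡ : ∀ {d} (U : Cube d) (f g : Cube d → Bool) (x : Cube d) → outZeros U (λ w → f w ∨ g w) x ℕ.≤ outZeros U f x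
outZeros-∨ˡ []      f g []       = z≤n
outZeros-∨ˡ (u ∷ U) f g (x ∷ xs) =
  ℕₚ.+-mono-≤ (upZero-∨ˡ u x (f (true ∷ xs)) (g (true ∷ xs))) (outZeros-∨ˡ U (λ w → f (x ∷ w)) (λ w → g (x ∷ w)) xs)

outZeros-∨ʳ : ∀ {d} (U : Cube d) (f g : Cube d → Bool) (x : Cube d) → outZeros U (λ w → f w ∨ g w) x ℕ.≤ outZeros U g x
outZeros-∨ʳ []      f g []       = z≤n
outZeros-∨ʳ (u ∷ U) f g (x ∷ xs) =
  ℕₚ.+-mono-≤ (upZero-∨ʳ u x (f (true ∷ xs)) (g (true ∷ xs))) (outZeros-∨ʳ U (λ w → f (x ∷ w)) (λ w → g (x ∷ w)) xs)

0≤1/8 : 0ℚ ≤ 1/8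
0≤1/8 = toWitness {a? = 0ℚ ℚₚ.≤? 1/8} _

left right : Bool → Bool → Bool
left  a b = a
right a b = b

ι*root-isZero : ∀ a n → ι a * root (isZero a ℕ.+ n) ≡ ι a * root n
ι*root-isZero false n = trans (ℚₚ.*-zeroˡ (root (suc n))) (sym (ℚₚ.*-zeroˡ (root n)))
ι*root-isZero true  n = refl

-- The one-dimensional case: a and b are the values of the function on the current
-- edge, and N φ counts the neighbours in all other directions at which φ, applied
-- to the two values of the neighbouring edge, vanishes.
repair-sensitivity-edge : ∀ u a b (N : (Bool → Bool → Bool) → ℕ) →
  N _∨_ ℕ.≤ N left → N _∨_ ℕ.≤ N right → N _∨_ ℕ.+ N _∧_ ≡ N left ℕ.+ N right →
  avg (λ x → avg (λ z → avg (λ s → ι (pick (u ∧ s) x z a b) * root (isZero (pick (u ∧ not s) x z a b) ℕ.+ N (pick (u ∧ s) x z)))))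
  ≤ avg (λ x → ι (pick false x false a b) * root (upZero u x b ℕ.+ N (pick false x false)))
repair-sensitivity-edge false a b N _ _ _ = ℚₚ.≤-reflexive
  (trans (cong₂ (λ p q → ½ * (½ * (½ * (p + p) + ½ * (p + p)) + ½ * (½ * (q + q) + ½ * (q + q))))
           (ι*root-isZero a (N left)) (ι*root-isZero b (N right)))
    (lem (ι a * root (N left)) (ι b * root (N right))))
  where
  lem : ∀ p q → ½ * (½ * (½ * (p + p) + ½ * (p + p)) + ½ * (½ * (q + q) + ½ * (q + q))) ≡ ½ * (p + q)
  lem = solve-∀ ℚ-ring
-- Both values are 1 and no repair changes them, but the neighbouring values may be combined by ∧ or
-- ∨. This is the only case that uses concavity.
repair-sensitivity-edge true true true N ∨≤l ∨≤r modular =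
  ≤-from-diff (lem (root (N left)) (root (N right)) (root (N _∧_)) (root (N _∨_)))
    (0≤p*q 0≤1/8 (p≤q⇒0≤q-p (root-submodular ∨≤l ∨≤r modular)))
  where
  lem : ∀ l r c j → ½ * (1ℚ * l + 1ℚ * r) ≡
    ½ * (½ * (½ * (1ℚ * l + 1ℚ * l) + ½ * (1ℚ * l + 1ℚ * c)) + ½ * (½ * (1ℚ * r + 1ℚ * j) + ½ * (1ℚ * r + 1ℚ * r)))
    + 1/8 * (l + r - (j + c))
  lem = solve-∀ ℚ-ring
-- The violated edge. Membership in S matters at the lower end when z = 1 and at the upper end when
-- z = 0; the one violated edge counted on the right pays for both.
repair-sensitivity-edge true true false N ∨≤l _ _ =
  ≤-from-diff (lem (root (N left)) (root (suc (N left))) (root (suc (N _∨_))) (root (N right)) (root (suc (N right))) (root (N _∧_)))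
    (0≤p*q 0≤1/8 (0≤p+q (p≤q⇒0≤q-p (ℚₚ.+-mono-≤ l≤l′ l≤l′)) (p≤q⇒0≤q-p (root-mono (s≤s ∨≤l)))))
  where
  l≤l′ : root (N left) ≤ root (suc (N left))
  l≤l′ = root-mono (ℕₚ.n≤1+n (N left))
  lem : ∀ l l′ j′ r r′ c → ½ * (1ℚ * l′ + 0ℚ * r) ≡
    ½ * (½ * (½ * (1ℚ * l + 1ℚ * l) + ½ * (1ℚ * l′ + 0ℚ * c)) + ½ * (½ * (0ℚ * r + 1ℚ * j′) + ½ * (0ℚ * r′ + 0ℚ * r′)))
    + 1/8 * ((l′ + l′ - (l + l)) + (l′ - j′))
  lem = solve-∀ ℚ-ring
repair-sensitivity-edge true false true N _ ∨≤r _ =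
  ≤-from-diff (lem (root (N left)) (root (suc (N left))) (root (N _∨_)) (root (N right)) (root (suc (N _∧_))))
    (0≤p*q 0≤1/8 (p≤q⇒0≤q-p (root-mono ∨≤r)))
  where
  lem : ∀ l l′ j r c′ → ½ * (0ℚ * l + 1ℚ * r) ≡
    ½ * (½ * (½ * (0ℚ * l′ + 0ℚ * l′) + ½ * (0ℚ * l′ + 0ℚ * c′)) + ½ * (½ * (1ℚ * r + 1ℚ * j) + ½ * (1ℚ * r + 1ℚ * r)))
    + 1/8 * (r - j)
  lem = solve-∀ ℚ-ring
repair-sensitivity-edge true false false N _ _ _ =
  ℚₚ.≤-reflexive (lem (root (suc (N left))) (root (suc (N _∧_))) (root (suc (N right))) (root (suc (N _∨_))) (root (N right)))
  where
  lem : ∀ l′ c′ r′ j′ r →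
    ½ * (½ * (½ * (0ℚ * l′ + 0ℚ * l′) + ½ * (0ℚ * l′ + 0ℚ * c′)) + ½ * (½ * (0ℚ * r′ + 0ℚ * j′) + ½ * (0ℚ * r′ + 0ℚ * r′)))
    ≡ ½ * (0ℚ * l′ + 0ℚ * r)
  lem = solve-∀ ℚ-ring

-- The functions E stand for f at the neighbours in the directions already treated
-- by the induction.
repair-sensitivity : ∀ {d k} (U : Cube d) (f : Cube d → Bool) (E : Fin k → Cube d → Bool) →
  𝔼 (λ x → 𝔼 (λ z → 𝔼 (λ S → ι (repair (U ∩ S) z f x) *
    root (zeros (λ j → repair (U ∩ S) z (E j) x) ℕ.+ sens (λ S′ → repair (U ∩ S′) z f x) S))))
  ≤ 𝔼 (λ x → ι (f x) * root (zeros (λ j → E j x) ℕ.+ outZeros U f x))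
repair-sensitivity []      f E = ℚₚ.≤-refl
repair-sensitivity {suc d} {k} (u ∷ U) f E = begin
  avg (λ x → 𝔼 (λ xs → avg (λ z → 𝔼 (λ zs → avg (λ s → 𝔼 (λ S → T x z s xs zs S))))))
    ≡⟨ avg-cong (λ x → trans (𝔼-avg (λ z xs → 𝔼 (λ zs → avg (λ s → 𝔼 (λ S → T x z s xs zs S)))))
        (avg-cong (λ z → trans (𝔼-cong (λ xs → 𝔼-avg (λ s zs → 𝔼 (λ S → T x z s xs zs S)))) (𝔼-avg (λ s xs → 𝔼 (λ zs → 𝔼 (λ S → T x z s xs zs S))))))) ⟩
  avg (λ x → avg (λ z → avg (λ s → 𝔼 (λ xs → 𝔼 (λ zs → 𝔼 (λ S → T x z s xs zs S))))))
    ≤⟨ avg-mono (λ x → avg-mono (λ z → avg-mono (λ s → induct x z s))) ⟩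
  avg (λ x → avg (λ z → avg (λ s → 𝔼 (T′ x z s))))
    ≡⟨ avg-cong (λ x → trans (avg-cong (λ z → sym (𝔼-avg (T′ x z)))) (sym (𝔼-avg (λ z w → avg (λ s → T′ x z s w))))) ⟩
  avg (λ x → 𝔼 (λ w → avg (λ z → avg (λ s → T′ x z s w))))
    ≡⟨ sym (𝔼-avg (λ x w → avg (λ z → avg (λ s → T′ x z s w)))) ⟩
  𝔼 (λ w → avg (λ x → avg (λ z → avg (λ s → T′ x z s w))))
    ≤⟨ 𝔼-mono edge ⟩
  𝔼 (λ w → avg (λ x → R x w))
    ≡⟨ 𝔼-avg R ⟩
  avg (λ x → 𝔼 (R x)) ∎
  where
  open ℚₚ.≤-Reasoning
  g : (Cube (suc d) → Bool) → Bool → Bool → Bool → Cube d → Bool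
  g h s x z w = pick s x z (h (false ∷ w)) (h (true ∷ w))
  T : Bool → Bool → Bool → Cube d → Cube d → Cube d → ℚ
  T x z s xs zs S = ι (repair (U ∩ S) zs (g f (u ∧ s) x z) xs) *
    root (zeros (λ j → repair (U ∩ S) zs (g (E j) (u ∧ s) x z) xs)
      ℕ.+ (isZero (repair (U ∩ S) zs (g f (u ∧ not s) x z) xs) ℕ.+ sens (λ S′ → repair (U ∩ S′) zs (g f (u ∧ s) x z) xs) S))
  -- Flipping the first bit of S leads to a neighbour in the cube of sets S. The function repaired
  -- with the flipped bit therefore joins the family.
  E′ : Bool → Bool → Bool → Fin (suc k) → Cube d → Bool
  E′ x z s zero    = g f (u ∧ not s) x z
  E′ x z s (suc j) = g (E j) (u ∧ s) x z
  N : Cube d → (Bool → Bool → Bool) → ℕ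
  N w φ = zeros (λ j → φ (E j (false ∷ w)) (E j (true ∷ w))) ℕ.+ outZeros U (λ v → φ (f (false ∷ v)) (f (true ∷ v))) w
  T′ : Bool → Bool → Bool → Cube d → ℚ
  T′ x z s w = ι (g f (u ∧ s) x z w) * root (isZero (g f (u ∧ not s) x z w) ℕ.+ N w (pick (u ∧ s) x z))
  R : Bool → Cube d → ℚ
  R x w = ι (f (x ∷ w)) * root (zeros (λ j → E j (x ∷ w)) ℕ.+ (upZero u x (f (true ∷ w)) ℕ.+ outZeros U (λ v → f (x ∷ v)) w))
  swap-+ : ∀ p q r → p ℕ.+ (q ℕ.+ r) ≡ q ℕ.+ p ℕ.+ r
  swap-+ = ℕ-RingSolver.solve-∀
  induct : ∀ x z s → 𝔼 (λ xs → 𝔼 (λ zs → 𝔼 (λ S → T x z s xs zs S))) ≤ 𝔼 (T′ x z s)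
  induct x z s = subst₂ _≤_
    (𝔼-cong (λ xs → 𝔼-cong (λ zs → 𝔼-cong (λ S → cong (λ n → ι (repair (U ∩ S) zs (g f (u ∧ s) x z) xs) * root n)
      (sym (swap-+ (zeros (λ j → repair (U ∩ S) zs (g (E j) (u ∧ s) x z) xs))
        (isZero (repair (U ∩ S) zs (g f (u ∧ not s) x z) xs)) (sens (λ S′ → repair (U ∩ S′) zs (g f (u ∧ s) x z) xs) S)))))))
    (𝔼-cong (λ w → cong (λ n → ι (g f (u ∧ s) x z w) * root n) (ℕₚ.+-assoc (isZero (g f (u ∧ not s) x z w)) _ _)))
    (repair-sensitivity U (g f (u ∧ s) x z) (E′ x z s))
  edge : ∀ w → avg (λ x → avg (λ z → avg (λ s → T′ x z s w))) ≤ avg (λ x → R x w)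
  edge w = ℚₚ.≤-trans
    (repair-sensitivity-edge u (f (false ∷ w)) (f (true ∷ w)) (N w)
      (ℕₚ.+-mono-≤ (zeros-∨ˡ e₀ e₁) (outZeros-∨ˡ U f₀ f₁ w))
      (ℕₚ.+-mono-≤ (zeros-∨ʳ e₀ e₁) (outZeros-∨ʳ U f₀ f₁ w))
      (trans (+-interchange (zeros (λ j → e₀ j ∨ e₁ j)) _ _ _)
        (trans (cong₂ ℕ._+_ (zeros-modular e₀ e₁) (outZeros-modular U f₀ f₁ w)) (+-interchange (zeros e₀) _ _ _))))
    (ℚₚ.≤-reflexive (cong₂ (λ m n → ½ * (ι (f (false ∷ w)) * root m + ι (f (true ∷ w)) * root n))
      (exchange (upZero u false (f (true ∷ w))) (zeros e₀) _)
      (exchange (upZero u true (f (true ∷ w))) (zeros e₁) _)))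
    where
    exchange : ∀ p q r → p ℕ.+ (q ℕ.+ r) ≡ q ℕ.+ (p ℕ.+ r)
    exchange = ℕ-RingSolver.solve-∀
    e₀ e₁ : Fin k → Bool
    e₀ j = E j (false ∷ w)
    e₁ j = E j (true ∷ w)
    f₀ f₁ : Cube d → Bool
    f₀ v = f (false ∷ v)
    f₁ v = f (true ∷ v)

-- Energy, and repairs along complementary sets

energy : ∀ {d} → Cube d → (Cube d → Bool) → ℚ
energy U f = 𝔼 (λ x → ι (f x) * root (outZeros U f x))

energy-nonNeg : ∀ {d} (U : Cube d) f → 0ℚ ≤ energy U f
energy-nonNeg U f = 𝔼-nonNeg (λ x → 0≤p*q (ι-nonNeg (f x)) (root-nonNeg (outZeros U f x)))

2ℚ : ℚ
2ℚ = fromℕ 2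

𝔼-neq : ∀ {d} (A : Cube d → Bool) → 𝔼 (λ S → 𝔼 (λ S′ → neq (A S) (A S′))) ≡ 2ℚ * var (μ A)
𝔼-neq {d} A = begin
  𝔼 (λ S → 𝔼 (λ S′ → neq (A S) (A S′)))                     ≡⟨ 𝔼-cong (λ S → 𝔼-cong (λ S′ → neq-linear (A S) (A S′))) ⟩
  𝔼 (λ S → 𝔼 (λ S′ → ι (A S) + (1ℚ - 2ℚ * ι (A S)) * ι (A S′)))
    ≡⟨ 𝔼-cong (λ S → affine (ι (A S)) (1ℚ - 2ℚ * ι (A S))) ⟩
  𝔼 (λ S → ι (A S) + (1ℚ - 2ℚ * ι (A S)) * m)               ≡⟨ 𝔼-cong (λ S → lem₁ (ι (A S)) m) ⟩
  𝔼 (λ S → m + (1ℚ - 2ℚ * m) * ι (A S))                     ≡⟨ affine m (1ℚ - 2ℚ * m) ⟩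
  m + (1ℚ - 2ℚ * m) * m                                     ≡⟨ lem₂ m ⟩
  2ℚ * var m                                                ∎
  where
  open ≡-Reasoning
  m = μ A
  affine : ∀ c e → 𝔼 (λ S → c + e * ι (A S)) ≡ c + e * m
  affine c e = trans (𝔼-+ (λ _ → c) (λ S → e * ι (A S))) (cong₂ _+_ (𝔼-const d c) (𝔼-* e (λ S → ι (A S))))
  neq-linear : ∀ a b → neq a b ≡ ι a + (1ℚ - 2ℚ * ι a) * ι b
  neq-linear = toWitness {a? = all-Bool? λ a → all-Bool? λ b → neq a b ℚₚ.≟ ι a + (1ℚ - 2ℚ * ι a) * ι b} _
  lem₁ : ∀ a m → a + (1ℚ - 2ℚ * a) * m ≡ m + (1ℚ - 2ℚ * m) * a
  lem₁ = solve-∀ ℚ-ring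
  lem₂ : ∀ m → m + (1ℚ - 2ℚ * m) * m ≡ 2ℚ * (m * (1ℚ - m))
  lem₂ = solve-∀ ℚ-ring

complement : ∀ {d} → Cube d → Cube d
complement = Vec.map not

-- S and its complement are dependent but both uniform; inserting an independent S′ between them
-- costs twice the independent case.
𝔼-neq-complement : ∀ {d} (A : Cube d → Bool) → 𝔼 (λ S → neq (A S) (A (complement S))) ≤ 4ℚ * var (μ A)
𝔼-neq-complement {d} A = begin
  𝔼 (λ S → neq (A S) (A (complement S)))
    ≡⟨ 𝔼-cong (λ S → sym (𝔼-const d (neq (A S) (A (complement S))))) ⟩
  𝔼 {d} (λ S → 𝔼 {d} (λ S′ → neq (A S) (A (complement S))))
    ≤⟨ 𝔼-mono (λ S → 𝔼-mono (λ S′ → neq-triangle (A S) (A S′) (A (complement S)))) ⟩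
  𝔼 (λ S → 𝔼 (λ S′ → neq (A S) (A S′) + neq (A S′) (A (complement S))))
    ≡⟨ 𝔼-cong (λ S → 𝔼-+ (λ S′ → neq (A S) (A S′)) (λ S′ → neq (A S′) (A (complement S)))) ⟩
  𝔼 (λ S → 𝔼 (λ S′ → neq (A S) (A S′)) + 𝔼 (λ S′ → neq (A S′) (A (complement S))))
    ≡⟨ 𝔼-+ (λ S → 𝔼 (λ S′ → neq (A S) (A S′))) (λ S → 𝔼 (λ S′ → neq (A S′) (A (complement S)))) ⟩
  𝔼 (λ S → 𝔼 (λ S′ → neq (A S) (A S′))) + 𝔼 (λ S → 𝔼 (λ S′ → neq (A S′) (A (complement S))))
    ≡⟨ cong₂ _+_ (𝔼-neq A) (trans (𝔼-not (λ S → 𝔼 (λ S′ → neq (A S′) (A S))))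
        (trans (𝔼-swap (λ S S′ → neq (A S′) (A S))) (𝔼-neq A))) ⟩
  2ℚ * var (μ A) + 2ℚ * var (μ A)         ≡⟨ lem (var (μ A)) ⟩
  4ℚ * var (μ A)                          ∎
  where
  open ℚₚ.≤-Reasoning
  lem : ∀ v → 2ℚ * v + 2ℚ * v ≡ 4ℚ * v
  lem = solve-∀ ℚ-ring

-- For fixed x and z, Talagrand's inequality is applied to the set of those S for which the repaired
-- value at x is 1. Averaged over x and z, its right side is what `repair-sensitivity` bounds,
-- started from an empty family.
repair-complement : ∀ {d} (U : Cube d) f →
  𝔼 (λ S → 𝔼 (λ z → dist (repair (U ∩ S) z f) (repair (U ∩ complement S) z f))) ≤ 4ℚ * energy U f
repair-complement {d} U f = begin
  𝔼 (λ S → 𝔼 (λ z → 𝔼 (λ x → Q x z S)))          ≡⟨ 𝔼-cong (λ S → 𝔼-swap (λ z x → Q x z S)) ⟩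
  𝔼 (λ S → 𝔼 (λ x → 𝔼 (λ z → Q x z S)))          ≡⟨ 𝔼-swap (λ S x → 𝔼 (λ z → Q x z S)) ⟩
  𝔼 (λ x → 𝔼 (λ S → 𝔼 (λ z → Q x z S)))          ≡⟨ 𝔼-cong (λ x → 𝔼-swap (λ S z → Q x z S)) ⟩
  𝔼 (λ x → 𝔼 (λ z → 𝔼 (λ S → Q x z S)))
    ≤⟨ 𝔼-mono (λ x → 𝔼-mono (λ z → ℚₚ.≤-trans (𝔼-neq-complement (A x z)) (*-monoˡ (fromℕ-nonNeg 4) (talagrand-root (A x z))))) ⟩
  𝔼 (λ x → 𝔼 (λ z → 4ℚ * 𝔼 (V x z)))              ≡⟨ 𝔼-cong (λ x → 𝔼-* 4ℚ (λ z → 𝔼 (V x z))) ⟩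
  𝔼 (λ x → 4ℚ * 𝔼 (λ z → 𝔼 (V x z)))              ≡⟨ 𝔼-* 4ℚ (λ x → 𝔼 (λ z → 𝔼 (V x z))) ⟩
  4ℚ * 𝔼 (λ x → 𝔼 (λ z → 𝔼 (V x z)))              ≤⟨ *-monoˡ (fromℕ-nonNeg 4) (repair-sensitivity {k = 0} U f (λ ())) ⟩
  4ℚ * energy U f                                 ∎
  where
  open ℚₚ.≤-Reasoning
  A : Cube d → Cube d → Cube d → Bool
  A x z S = repair (U ∩ S) z f x
  Q : Cube d → Cube d → Cube d → ℚ
  Q x z S = neq (A x z S) (A x z (complement S))
  V : Cube d → Cube d → Cube d → ℚ
  V x z S = ι (A x z S) * root (sens (A x z) S)

-- The energy of a random half

upZero-split : ∀ u s x v → upZero (u ∧ s) x v ℕ.+ upZero (u ∧ not s) x v ≡ upZero u x v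
upZero-split false s     x     v = refl
upZero-split true  false x     v = refl
upZero-split true  true  false v = ℕₚ.+-identityʳ (isZero v)
upZero-split true  true  true  v = refl

outZeros-split : ∀ {d} (U S : Cube d) (f : Cube d → Bool) x → outZeros (U ∩ S) f x ℕ.+ outZeros (U ∩ complement S) f x ≡ outZeros U f x
outZeros-split []      []      f []       = refl
outZeros-split (u ∷ U) (s ∷ S) f (x ∷ xs) = trans (+-interchange (upZero (u ∧ s) x (f (true ∷ xs))) _ _ _)
  (cong₂ ℕ._+_ (upZero-split u s x (f (true ∷ xs))) (outZeros-split U S (λ w → f (x ∷ w)) xs))

energy-∩ : ∀ {d} (U S : Cube d) f → energy (U ∩ S) f ≤ energy U f
energy-∩ U S f = 𝔼-mono (λ x → *-monoˡ (ι-nonNeg (f x))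
  (root-mono (subst (outZeros (U ∩ S) f x ℕ.≤_) (outZeros-split U S f x) (ℕₚ.m≤m+n _ _))))

3/4 : ℚ
3/4 = + 3 / 4

-- S and its complement have the same distribution and divide the violated edges at each point, so
-- `root-split` applies pointwise: 3/4 is half of 3/2.
energy-half : ∀ {d} (U : Cube d) f → 𝔼 (λ S → energy (U ∩ S) f) ≤ 3/4 * energy U f
energy-half {d} U f = begin
  𝔼 (λ S → energy (U ∩ S) f)                                     ≡⟨ double (𝔼 (λ S → energy (U ∩ S) f)) ⟩
  ½ * (𝔼 (λ S → energy (U ∩ S) f) + 𝔼 (λ S → energy (U ∩ S) f))
    ≡⟨ cong (λ h → ½ * (𝔼 (λ S → energy (U ∩ S) f) + h)) (sym (𝔼-not (λ S → energy (U ∩ S) f))) ⟩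
  ½ * (𝔼 (λ S → energy (U ∩ S) f) + 𝔼 (λ S → energy (U ∩ complement S) f))
    ≡⟨ cong (λ h → ½ * h) (sym (𝔼-+ (λ S → energy (U ∩ S) f) (λ S → energy (U ∩ complement S) f))) ⟩
  ½ * 𝔼 (λ S → energy (U ∩ S) f + energy (U ∩ complement S) f)   ≤⟨ *-monoˡ 0≤½ (𝔼-mono split) ⟩
  ½ * 𝔼 {d} (λ S → (+ 3 / 2) * energy U f)                       ≡⟨ cong (λ h → ½ * h) (𝔼-const d _) ⟩
  ½ * ((+ 3 / 2) * energy U f)                                   ≡⟨ lem (energy U f) ⟩
  3/4 * energy U f                                               ∎
  where
  open ℚₚ.≤-Reasoning
  double : ∀ p → p ≡ ½ * (p + p)
  double = solve-∀ ℚ-ring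
  lem : ∀ p → ½ * ((+ 3 / 2) * p) ≡ 3/4 * p
  lem = solve-∀ ℚ-ring
  distrib : ∀ i a b → i * (a + b) ≡ i * a + i * b
  distrib = solve-∀ ℚ-ring
  reassoc : ∀ i a → i * ((+ 3 / 2) * a) ≡ (+ 3 / 2) * (i * a)
  reassoc = solve-∀ ℚ-ring
  split : ∀ S → energy (U ∩ S) f + energy (U ∩ complement S) f ≤ (+ 3 / 2) * energy U f
  split S = begin
    energy (U ∩ S) f + energy (U ∩ complement S) f
      ≡⟨ sym (𝔼-+ (λ x → ι (f x) * r S x) (λ x → ι (f x) * r (complement S) x)) ⟩
    𝔼 (λ x → ι (f x) * r S x + ι (f x) * r (complement S) x)
      ≡⟨ 𝔼-cong (λ x → sym (distrib (ι (f x)) (r S x) (r (complement S) x))) ⟩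
    𝔼 (λ x → ι (f x) * (r S x + r (complement S) x))
      ≤⟨ 𝔼-mono (λ x → *-monoˡ (ι-nonNeg (f x)) (subst (λ n → r S x + r (complement S) x ≤ (+ 3 / 2) * root n)
           (outZeros-split U S f x) (root-split (outZeros (U ∩ S) f x) (outZeros (U ∩ complement S) f x)))) ⟩
    𝔼 (λ x → ι (f x) * ((+ 3 / 2) * root (outZeros U f x)))
      ≡⟨ 𝔼-cong (λ x → reassoc (ι (f x)) (root (outZeros U f x))) ⟩
    𝔼 (λ x → (+ 3 / 2) * (ι (f x) * root (outZeros U f x)))
      ≡⟨ 𝔼-* (+ 3 / 2) (λ x → ι (f x) * root (outZeros U f x)) ⟩
    (+ 3 / 2) * energy U f ∎
    where
    r : Cube d → Cube d → ℚ
    r S x = root (outZeros (U ∩ S) f x)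

MonotoneIn-split : ∀ {d} (U S : Cube d) {f} → MonotoneIn (U ∩ S) f → MonotoneIn (U ∩ complement S) f → MonotoneIn U f
MonotoneIn-split []          []          _          _          = tt
MonotoneIn-split (u ∷ U)     (false ∷ S) (_ , fs)   (f₀₁ , gs) =
  (λ { refl → f₀₁ refl }) , (λ b → MonotoneIn-split U S (fs b) (gs b))
MonotoneIn-split (u ∷ U)     (true ∷ S)  (f₀₁ , fs) (_ , gs)   =
  (λ { refl → f₀₁ refl }) , (λ b → MonotoneIn-split U S (fs b) (gs b))

-- Following a sequence of repairs

endpoint : ∀ {d} → Cube d → List (Cube d) → Cube d
endpoint M []        = M
endpoint M (M′ ∷ Ms) = endpoint M′ Ms

pathLength : ∀ {d} → Cube d → (Cube d → Bool) → Cube d → List (Cube d) → ℚ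
pathLength z f M []        = 0ℚ
pathLength z f M (M′ ∷ Ms) = dist (repair M z f) (repair M′ z f) + pathLength z f M′ Ms

-- repair M′ ζ moves C no further from repair M′ z f than C is, for a suitable ζ,
-- because it fixes repair M′ z f.
repair-along : ∀ {d} (z : Cube d) f C M (Ms : List (Cube d)) → ∃ λ C′ →
  (∀ V → MonotoneIn V C → MonotoneIn V C′) × All (λ V → MonotoneIn V C′) Ms ×
  dist C′ (repair (endpoint M Ms) z f) ≤ dist C (repair M z f) + pathLength z f M Ms
repair-along z f C M [] = C , (λ _ m → m) , [] , ℚₚ.≤-reflexive (sym (ℚₚ.+-identityʳ _))
repair-along z f C M (M′ ∷ Ms) with 𝔼-attained (λ ζ → dist (repair M′ ζ C) (repair M′ ζ (repair M′ z f)))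
... | ζ , dist≤ with repair-along z f (repair M′ ζ C) M′ Ms
... | C′ , preserves , monotone , le =
  C′ , (λ V m → preserves V (repair-preserves V M′ ζ m)) , (preserves M′ (repair-monotone M′ ζ C) ∷ monotone) , (begin
    dist C′ (repair (endpoint M′ Ms) z f)                              ≤⟨ le ⟩
    dist (repair M′ ζ C) (repair M′ z f) + pathLength z f M′ Ms        ≤⟨ ℚₚ.+-monoˡ-≤ (pathLength z f M′ Ms) closer ⟩
    dist C (repair M z f) + dist (repair M z f) (repair M′ z f) + pathLength z f M′ Ms ≡⟨ ℚₚ.+-assoc (dist C (repair M z f)) _ _ ⟩
    dist C (repair M z f) + (dist (repair M z f) (repair M′ z f) + pathLength z f M′ Ms) ∎)
  where
  open ℚₚ.≤-Reasoning
  closer : dist (repair M′ ζ C) (repair M′ z f) ≤ dist C (repair M z f) + dist (repair M z f) (repair M′ z f)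
  closer = begin
    dist (repair M′ ζ C) (repair M′ z f)
      ≡⟨ dist-cong {f = repair M′ ζ C} (λ _ → refl) (λ x → sym (repair-id M′ ζ (repair-monotone M′ z f) x)) ⟩
    dist (repair M′ ζ C) (repair M′ ζ (repair M′ z f))                          ≤⟨ dist≤ ⟩
    𝔼 (λ ζ → dist (repair M′ ζ C) (repair M′ ζ (repair M′ z f)))                ≤⟨ repair-contraction M′ C (repair M′ z f) ⟩
    dist C (repair M′ z f)                                                      ≤⟨ dist-triangle C (repair M z f) (repair M′ z f) ⟩
    dist C (repair M z f) + dist (repair M z f) (repair M′ z f)                 ∎

-- Eight random cells

𝔼-≤const : ∀ {d} {F : Cube d → ℚ} {c} → (∀ x → F x ≤ c) → 𝔼 F ≤ c
𝔼-≤const {d} {F} {c} F≤c = subst (𝔼 F ≤_) (𝔼-const d c) (𝔼-mono F≤c)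

𝔼⁴ : ∀ {d} → (Cube d → Cube d → Cube d → Cube d → ℚ) → ℚ
𝔼⁴ F = 𝔼 (λ S₁ → 𝔼 (λ S₂ → 𝔼 (λ S₃ → 𝔼 (λ z → F S₁ S₂ S₃ z))))

𝔼⁴-+ : ∀ {d} (F G : Cube d → Cube d → Cube d → Cube d → ℚ) {a b} → 𝔼⁴ F ≤ a → 𝔼⁴ G ≤ b →
  𝔼⁴ (λ S₁ S₂ S₃ z → F S₁ S₂ S₃ z + G S₁ S₂ S₃ z) ≤ a + b
𝔼⁴-+ F G F≤a G≤b = ℚₚ.≤-trans (ℚₚ.≤-reflexive (trans
  (𝔼-cong (λ S₁ → trans
    (𝔼-cong (λ S₂ → trans
      (𝔼-cong (λ S₃ → 𝔼-+ (F S₁ S₂ S₃) (G S₁ S₂ S₃)))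
      (𝔼-+ (λ S₃ → 𝔼 (F S₁ S₂ S₃)) (λ S₃ → 𝔼 (G S₁ S₂ S₃)))))
    (𝔼-+ (λ S₂ → 𝔼 (λ S₃ → 𝔼 (F S₁ S₂ S₃))) (λ S₂ → 𝔼 (λ S₃ → 𝔼 (G S₁ S₂ S₃))))))
  (𝔼-+ (λ S₁ → 𝔼 (λ S₂ → 𝔼 (λ S₃ → 𝔼 (F S₁ S₂ S₃)))) (λ S₁ → 𝔼 (λ S₂ → 𝔼 (λ S₃ → 𝔼 (G S₁ S₂ S₃)))))))
  (ℚₚ.+-mono-≤ F≤a G≤b)

𝔼⁴-attained : ∀ {d} (F : Cube d → Cube d → Cube d → Cube d → ℚ) →
  ∃ λ S₁ → ∃ λ S₂ → ∃ λ S₃ → ∃ λ z → F S₁ S₂ S₃ z ≤ 𝔼⁴ F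
𝔼⁴-attained F with 𝔼-attained (λ S₁ → 𝔼 (λ S₂ → 𝔼 (λ S₃ → 𝔼 (F S₁ S₂ S₃))))
... | S₁ , le₁ with 𝔼-attained (λ S₂ → 𝔼 (λ S₃ → 𝔼 (F S₁ S₂ S₃)))
... | S₂ , le₂ with 𝔼-attained (λ S₃ → 𝔼 (F S₁ S₂ S₃))
... | S₃ , le₃ with 𝔼-attained (F S₁ S₂ S₃)
... | z , le₄ = S₁ , S₂ , S₃ , z , ℚₚ.≤-trans le₄ (ℚₚ.≤-trans le₃ (ℚₚ.≤-trans le₂ le₁))

literal : ∀ {d} → Bool → Cube d → Cube d
literal false S = complement S
literal true  S = S

energy-literal : ∀ {d} (U S : Cube d) f c → energy (U ∩ literal c S) f ≤ energy U f
energy-literal U S f c = energy-∩ U (literal c S) f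

∩-swapʳ : ∀ {d} (U S T : Cube d) → (U ∩ S) ∩ T ≡ (U ∩ T) ∩ S
∩-swapʳ []      []      []      = refl
∩-swapʳ (u ∷ U) (s ∷ S) (t ∷ T) = cong₂ _∷_ (swap u s t) (∩-swapʳ U S T)
  where
  swap : ∀ u s t → (u ∧ s) ∧ t ≡ (u ∧ t) ∧ s
  swap = toWitness {a? = all-Bool? λ u → all-Bool? λ s → all-Bool? λ t → ((u ∧ s) ∧ t) Boolₚ.≟ ((u ∧ t) ∧ s)} _

-- Three random sets are taken because `2 (3/4)³ < 1`, whereas `2 (3/4)² > 1`.
module Octants {d} (U : Cube d) (f : Cube d → Bool) where

  cell : Bool → Bool → Bool → Cube d → Cube d → Cube d → Cube d
  cell c₁ c₂ c₃ S₁ S₂ S₃ = ((U ∩ literal c₁ S₁) ∩ literal c₂ S₂) ∩ literal c₃ S₃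

  step : Cube d → Cube d → Cube d → ℚ
  step z M M′ = dist (repair M z f) (repair M′ z f)

  toggle : ∀ W c → 𝔼 (λ S → 𝔼 (λ z → step z (W ∩ literal c S) (W ∩ literal (not c) S))) ≤ 4ℚ * energy W f
  toggle W true  = repair-complement W f
  toggle W false = subst (_≤ 4ℚ * energy W f)
    (𝔼-cong (λ S → 𝔼-cong (λ z → dist-sym (repair (W ∩ S) z f) (repair (W ∩ complement S) z f))))
    (repair-complement W f)

  energy-literal² : ∀ c₁ c₂ S₁ S₂ → energy ((U ∩ literal c₁ S₁) ∩ literal c₂ S₂) f ≤ energy U f
  energy-literal² c₁ c₂ S₁ S₂ = ℚₚ.≤-trans (energy-literal (U ∩ literal c₁ S₁) S₂ f c₂) (energy-literal U S₁ f c₁)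

  toggle₃ : ∀ c₁ c₂ c₃ → 𝔼⁴ (λ S₁ S₂ S₃ z → step z (cell c₁ c₂ c₃ S₁ S₂ S₃) (cell c₁ c₂ (not c₃) S₁ S₂ S₃)) ≤ 4ℚ * energy U f
  toggle₃ c₁ c₂ c₃ = 𝔼-≤const (λ S₁ → 𝔼-≤const (λ S₂ →
    ℚₚ.≤-trans (toggle ((U ∩ literal c₁ S₁) ∩ literal c₂ S₂) c₃) (*-monoˡ (fromℕ-nonNeg 4) (energy-literal² c₁ c₂ S₁ S₂))))

  -- Averages and intersections commute, so the toggled set can be moved to the innermost place,
  -- where `toggle₃` applies.
  toggle₂ : ∀ c₁ c₂ c₃ → 𝔼⁴ (λ S₁ S₂ S₃ z → step z (cell c₁ c₂ c₃ S₁ S₂ S₃) (cell c₁ (not c₂) c₃ S₁ S₂ S₃)) ≤ 4ℚ * energy U f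
  toggle₂ c₁ c₂ c₃ = subst (_≤ 4ℚ * energy U f)
    (𝔼-cong (λ S₁ → trans
      (𝔼-swap (λ S₃ S₂ → 𝔼 (λ z → step z (((U ∩ literal c₁ S₁) ∩ literal c₃ S₃) ∩ literal c₂ S₂) (((U ∩ literal c₁ S₁) ∩ literal c₃ S₃) ∩ literal (not c₂) S₂))))
      (𝔼-cong (λ S₂ → 𝔼-cong (λ S₃ → 𝔼-cong (λ z → cong₂ (step z)
        (∩-swapʳ (U ∩ literal c₁ S₁) (literal c₃ S₃) (literal c₂ S₂))
        (∩-swapʳ (U ∩ literal c₁ S₁) (literal c₃ S₃) (literal (not c₂) S₂))))))))
    (toggle₃ c₁ c₃ c₂)

  toggle₁ : ∀ c₁ c₂ c₃ → 𝔼⁴ (λ S₁ S₂ S₃ z → step z (cell c₁ c₂ c₃ S₁ S₂ S₃) (cell (not c₁) c₂ c₃ S₁ S₂ S₃)) ≤ 4ℚ * energy U f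
  toggle₁ c₁ c₂ c₃ = subst (_≤ 4ℚ * energy U f)
    (trans
      (𝔼-swap (λ S₂ S₁ → 𝔼 (λ S₃ → 𝔼 (λ z → step z (((U ∩ literal c₂ S₂) ∩ literal c₁ S₁) ∩ literal c₃ S₃) (((U ∩ literal c₂ S₂) ∩ literal (not c₁) S₁) ∩ literal c₃ S₃)))))
      (𝔼-cong (λ S₁ → 𝔼-cong (λ S₂ → 𝔼-cong (λ S₃ → 𝔼-cong (λ z → cong₂ (λ M M′ → step z (M ∩ literal c₃ S₃) (M′ ∩ literal c₃ S₃))
        (∩-swapʳ U (literal c₂ S₂) (literal c₁ S₁))
        (∩-swapʳ U (literal c₂ S₂) (literal (not c₁) S₁))))))))
    (toggle₂ c₂ c₁ c₃)

  -- A Gray code: consecutive cells differ in one literal.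
  first : Cube d → Cube d → Cube d → Cube d
  first = cell false true true

  rest : Cube d → Cube d → Cube d → List (Cube d)
  rest S₁ S₂ S₃ =
    cell false true false S₁ S₂ S₃ ∷ cell false false false S₁ S₂ S₃ ∷ cell false false true S₁ S₂ S₃ ∷
    cell true false true S₁ S₂ S₃ ∷ cell true false false S₁ S₂ S₃ ∷ cell true true false S₁ S₂ S₃ ∷
    cell true true true S₁ S₂ S₃ ∷ []

  last : Cube d → Cube d → Cube d → Cube d
  last = cell true true true

  -- Seven steps of the Gray code, each at the price 4.
  pathLength-bound : 𝔼⁴ (λ S₁ S₂ S₃ z → pathLength z f (first S₁ S₂ S₃) (rest S₁ S₂ S₃)) ≤ fromℕ 28 * energy U f
  pathLength-bound = subst (𝔼⁴ (λ S₁ S₂ S₃ z → pathLength z f (first S₁ S₂ S₃) (rest S₁ S₂ S₃)) ≤_) (lem (energy U f))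
    (𝔼⁴-+ (λ S₁ S₂ S₃ z → step z (cell false true true S₁ S₂ S₃) (cell false true false S₁ S₂ S₃)) _ (toggle₃ false true true)
    (𝔼⁴-+ (λ S₁ S₂ S₃ z → step z (cell false true false S₁ S₂ S₃) (cell false false false S₁ S₂ S₃)) _ (toggle₂ false true false)
    (𝔼⁴-+ (λ S₁ S₂ S₃ z → step z (cell false false false S₁ S₂ S₃) (cell false false true S₁ S₂ S₃)) _ (toggle₃ false false false)
    (𝔼⁴-+ (λ S₁ S₂ S₃ z → step z (cell false false true S₁ S₂ S₃) (cell true false true S₁ S₂ S₃)) _ (toggle₁ false false true)
    (𝔼⁴-+ (λ S₁ S₂ S₃ z → step z (cell true false true S₁ S₂ S₃) (cell true false false S₁ S₂ S₃)) _ (toggle₃ true false true)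
    (𝔼⁴-+ (λ S₁ S₂ S₃ z → step z (cell true false false S₁ S₂ S₃) (cell true true false S₁ S₂ S₃)) _ (toggle₂ true false false)
    (𝔼⁴-+ (λ S₁ S₂ S₃ z → step z (cell true true false S₁ S₂ S₃) (cell true true true S₁ S₂ S₃)) (λ _ _ _ _ → 0ℚ) (toggle₃ true true false)
      (𝔼-≤const {d} (λ _ → 𝔼-≤const {d} (λ _ → 𝔼-≤const {d} (λ _ → 𝔼-≤const {d} (λ _ → ℚₚ.≤-refl))))))))))))
    where
    lem : ∀ e → 4ℚ * e + (4ℚ * e + (4ℚ * e + (4ℚ * e + (4ℚ * e + (4ℚ * e + (4ℚ * e + 0ℚ)))))) ≡ fromℕ 28 * e
    lem = solve-∀ ℚ-ring

  monotone-along : ∀ S₁ S₂ S₃ {C} → MonotoneIn (first S₁ S₂ S₃) C → All (λ V → MonotoneIn V C) (rest S₁ S₂ S₃) → MonotoneIn U C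
  monotone-along S₁ S₂ S₃ m₀₁₁ (m₀₁₀ ∷ m₀₀₀ ∷ m₀₀₁ ∷ m₁₀₁ ∷ m₁₀₀ ∷ m₁₁₀ ∷ m₁₁₁ ∷ []) =
    MonotoneIn-split U S₁
      (MonotoneIn-split (U ∩ S₁) S₂ (MonotoneIn-split _ S₃ m₁₁₁ m₁₁₀) (MonotoneIn-split _ S₃ m₁₀₁ m₁₀₀))
      (MonotoneIn-split (U ∩ complement S₁) S₂ (MonotoneIn-split _ S₃ m₀₁₁ m₀₁₀) (MonotoneIn-split _ S₃ m₀₀₁ m₀₀₀))

-- Improving the constant

Approximable : ∀ d → ℚ → Set
Approximable d K = ∀ (U : Cube d) f → ∃ λ G → MonotoneIn U G × dist f G ≤ K * energy U f

-- The repair fixes G and contracts on average, so the repaired f is on average no further from G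
-- than f was.
repair-dist : ∀ {d} (M : Cube d) f G → MonotoneIn M G → 𝔼 (λ z → dist f (repair M z f)) ≤ 2ℚ * dist f G
repair-dist {d} M f G mono = begin
  𝔼 (λ z → dist f (repair M z f))                                    ≤⟨ 𝔼-mono (λ z → dist-triangle f G (repair M z f)) ⟩
  𝔼 (λ z → dist f G + dist G (repair M z f))                         ≡⟨ 𝔼-+ (λ _ → dist f G) (λ z → dist G (repair M z f)) ⟩
  𝔼 {d} (λ z → dist f G) + 𝔼 (λ z → dist G (repair M z f))
    ≡⟨ cong₂ _+_ (𝔼-const d (dist f G)) (𝔼-cong (λ z → dist-cong {g = repair M z f} (λ x → sym (repair-id M z mono x)) (λ _ → refl))) ⟩
  dist f G + 𝔼 (λ z → dist (repair M z G) (repair M z f))            ≤⟨ ℚₚ.+-monoʳ-≤ (dist f G) (repair-contraction M G f) ⟩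
  dist f G + dist G f                                                ≡⟨ cong (λ h → dist f G + h) (dist-sym G f) ⟩
  dist f G + dist f G                                                ≡⟨ lem (dist f G) ⟩
  2ℚ * dist f G                                                      ∎
  where
  open ℚₚ.≤-Reasoning
  lem : ∀ p → p + p ≡ 2ℚ * p
  lem = solve-∀ ℚ-ring

-- This is `2 (3/4)³`: the factor 2 of `repair-dist` and three halvings.
27/32 : ℚ
27/32 = + 27 / 32

-- The hypothesis is applied to the last cell, a random subset of U, and this is why `Approximable`
-- quantifies over all sets of directions.
approximable-step : ∀ {d K} → 0ℚ ≤ K → Approximable d K → Approximable d (27/32 * K + fromℕ 28)
approximable-step {d} {K} 0≤K approx U f = C , monotone-along S₁ S₂ S₃ (proj₁ (proj₂ along) (first S₁ S₂ S₃) (repair-monotone (first S₁ S₂ S₃) z f)) (proj₁ (proj₂ (proj₂ along))) , (begin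
  dist f C                                     ≤⟨ dist-triangle f (repair L z f) C ⟩
  dist f (repair L z f) + dist (repair L z f) C
    ≤⟨ ℚₚ.+-monoʳ-≤ (dist f (repair L z f)) (ℚₚ.≤-trans (ℚₚ.≤-reflexive (dist-sym (repair L z f) C)) close) ⟩
  total S₁ S₂ S₃ z                             ≤⟨ total≤ ⟩
  𝔼⁴ total                                     ≤⟨ 𝔼⁴-+ (λ S₁ S₂ S₃ z → dist f (repair (last S₁ S₂ S₃) z f)) _ last-close pathLength-bound ⟩
  2ℚ * (K * (3/4 * (3/4 * (3/4 * energy U f)))) + fromℕ 28 * energy U f ≡⟨ lem K (energy U f) ⟩
  (27/32 * K + fromℕ 28) * energy U f          ∎)
  where
  open ℚₚ.≤-Reasoning
  open Octants U f
  -- The distance to the last repair and the length of the path must be small for the same random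
  -- choice, so their sum is averaged.
  total : Cube d → Cube d → Cube d → Cube d → ℚ
  total S₁ S₂ S₃ z = dist f (repair (last S₁ S₂ S₃) z f) + pathLength z f (first S₁ S₂ S₃) (rest S₁ S₂ S₃)
  attained = 𝔼⁴-attained total
  S₁ = proj₁ attained
  S₂ = proj₁ (proj₂ attained)
  S₃ = proj₁ (proj₂ (proj₂ attained))
  z  = proj₁ (proj₂ (proj₂ (proj₂ attained)))
  total≤ : total S₁ S₂ S₃ z ≤ 𝔼⁴ total
  total≤ = proj₂ (proj₂ (proj₂ (proj₂ attained)))
  L = last S₁ S₂ S₃
  -- Starting at the first repair itself makes the initial error 0.
  C₀ = repair (first S₁ S₂ S₃) z f
  along = repair-along z f C₀ (first S₁ S₂ S₃) (rest S₁ S₂ S₃)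
  C = proj₁ along
  close : dist C (repair L z f) ≤ pathLength z f (first S₁ S₂ S₃) (rest S₁ S₂ S₃)
  close = ℚₚ.≤-trans (proj₂ (proj₂ (proj₂ along)))
    (ℚₚ.≤-reflexive (trans (cong (λ h → h + pathLength z f (first S₁ S₂ S₃) (rest S₁ S₂ S₃)) (dist-refl C₀)) (ℚₚ.+-identityˡ _)))
  last-close : 𝔼⁴ (λ S₁ S₂ S₃ z → dist f (repair (last S₁ S₂ S₃) z f)) ≤ 2ℚ * (K * (3/4 * (3/4 * (3/4 * energy U f))))
  last-close = begin
    𝔼⁴ (λ S₁ S₂ S₃ z → dist f (repair (last S₁ S₂ S₃) z f))
      ≤⟨ 𝔼-mono (λ S₁ → 𝔼-mono (λ S₂ → 𝔼-mono (λ S₃ → near (last S₁ S₂ S₃)))) ⟩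
    𝔼 (λ S₁ → 𝔼 (λ S₂ → 𝔼 (λ S₃ → 2K * energy (last S₁ S₂ S₃) f)))
      ≤⟨ 𝔼-mono (λ S₁ → 𝔼-mono (λ S₂ → halve ((U ∩ S₁) ∩ S₂))) ⟩
    𝔼 (λ S₁ → 𝔼 (λ S₂ → 2K * (3/4 * energy ((U ∩ S₁) ∩ S₂) f)))
      ≡⟨ 𝔼-cong (λ S₁ → 𝔼-cong (λ S₂ → sym (ℚₚ.*-assoc 2K 3/4 (energy ((U ∩ S₁) ∩ S₂) f)))) ⟩
    𝔼 (λ S₁ → 𝔼 (λ S₂ → 2K * 3/4 * energy ((U ∩ S₁) ∩ S₂) f))
      ≤⟨ 𝔼-mono (λ S₁ → scaled-half (2K * 3/4) 0≤2K*3/4 (U ∩ S₁)) ⟩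
    𝔼 (λ S₁ → 2K * 3/4 * (3/4 * energy (U ∩ S₁) f))
      ≡⟨ 𝔼-cong (λ S₁ → sym (ℚₚ.*-assoc (2K * 3/4) 3/4 (energy (U ∩ S₁) f))) ⟩
    𝔼 (λ S₁ → 2K * 3/4 * 3/4 * energy (U ∩ S₁) f)
      ≤⟨ scaled-half (2K * 3/4 * 3/4) (0≤p*q 0≤2K*3/4 0≤3/4) U ⟩
    2K * 3/4 * 3/4 * (3/4 * energy U f)
      ≡⟨ lem₂ K (energy U f) ⟩
    2ℚ * (K * (3/4 * (3/4 * (3/4 * energy U f)))) ∎
    where
    2K = 2ℚ * K
    0≤2K : 0ℚ ≤ 2K
    0≤2K = 0≤p*q (fromℕ-nonNeg 2) 0≤K
    0≤3/4 : 0ℚ ≤ 3/4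
    0≤3/4 = toWitness {a? = 0ℚ ℚₚ.≤? 3/4} _
    0≤2K*3/4 = 0≤p*q 0≤2K 0≤3/4
    scaled-half : ∀ c → 0ℚ ≤ c → ∀ W → 𝔼 (λ S → c * energy (W ∩ S) f) ≤ c * (3/4 * energy W f)
    scaled-half c 0≤c W = ℚₚ.≤-trans (ℚₚ.≤-reflexive (𝔼-* c (λ S → energy (W ∩ S) f))) (*-monoˡ 0≤c (energy-half W f))
    halve : ∀ W → 𝔼 (λ S → 2K * energy (W ∩ S) f) ≤ 2K * (3/4 * energy W f)
    halve = scaled-half 2K 0≤2K
    near : ∀ M → 𝔼 (λ z → dist f (repair M z f)) ≤ 2K * energy M f
    near M with approx M f
    ... | G , mono , dist≤ = ℚₚ.≤-trans (repair-dist M f G mono)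
      (ℚₚ.≤-trans (*-monoˡ (fromℕ-nonNeg 2) dist≤) (ℚₚ.≤-reflexive (sym (ℚₚ.*-assoc 2ℚ K (energy M f)))))
    lem₂ : ∀ K e → 2ℚ * K * 3/4 * 3/4 * (3/4 * e) ≡ 2ℚ * (K * (3/4 * (3/4 * (3/4 * e))))
    lem₂ = solve-∀ ℚ-ring
  lem : ∀ K e → 2ℚ * (K * (3/4 * (3/4 * (3/4 * e)))) + fromℕ 28 * e ≡ (27/32 * K + fromℕ 28) * e
  lem = solve-∀ ℚ-ring

-- The trivial constant

search : ∀ {d} {P Q : Cube d → Set} → (∀ x → P x ⊎ Q x) → (∀ x → P x) ⊎ ∃ Q
search {zero} P⊎Q with P⊎Q []
... | inj₁ p = inj₁ λ { [] → p }
... | inj₂ q = inj₂ ([] , q)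
search {suc d} P⊎Q with search (λ x → P⊎Q (false ∷ x)) | search (λ x → P⊎Q (true ∷ x))
... | inj₂ (x , q) | _            = inj₂ (false ∷ x , q)
... | inj₁ _       | inj₂ (x , q) = inj₂ (true ∷ x , q)
... | inj₁ p       | inj₁ p′      = inj₁ λ { (false ∷ x) → p x ; (true ∷ x) → p′ x }

pow2 : ℕ → ℚ
pow2 zero    = 1ℚ
pow2 (suc d) = 2ℚ * pow2 d

pow2-nonNeg : ∀ d → 0ℚ ≤ pow2 d
pow2-nonNeg zero    = 0≤1ℚ
pow2-nonNeg (suc d) = 0≤p*q (fromℕ-nonNeg 2) (pow2-nonNeg d)

point≤𝔼 : ∀ {d} {F : Cube d → ℚ} → (∀ x → 0ℚ ≤ F x) → ∀ x → F x ≤ pow2 d * 𝔼 F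
point≤𝔼 {zero} {F} 0≤F [] = ℚₚ.≤-reflexive (sym (ℚₚ.*-identityˡ (F [])))
point≤𝔼 {suc d} {F} 0≤F (b ∷ x) =
  ℚₚ.≤-trans (point≤𝔼 (λ y → 0≤F (b ∷ y)) x)
    (ℚₚ.≤-trans (*-monoˡ (pow2-nonNeg d) (half b)) (ℚₚ.≤-reflexive (lem (pow2 d) (𝔼 F))))
  where
  p = 𝔼 (λ y → F (false ∷ y))
  q = 𝔼 (λ y → F (true ∷ y))
  lem : ∀ k e → k * (2ℚ * e) ≡ 2ℚ * k * e
  lem = solve-∀ ℚ-ring
  lemˡ : ∀ p q → 2ℚ * (½ * (p + q)) ≡ p + q
  lemˡ = solve-∀ ℚ-ring
  lemʳ : ∀ p q → 2ℚ * (½ * (p + q)) ≡ q + p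
  lemʳ = solve-∀ ℚ-ring
  half : ∀ b → 𝔼 (λ y → F (b ∷ y)) ≤ 2ℚ * 𝔼 F
  half false = ≤-from-diff (lemˡ p q) (𝔼-nonNeg (λ y → 0≤F (true ∷ y)))
  half true  = ≤-from-diff (lemʳ p q) (𝔼-nonNeg (λ y → 0≤F (false ∷ y)))

no-outZeros⇒monotone : ∀ {d} (U : Cube d) f → (∀ x → f x ≡ true → outZeros U f x ≡ 0) → MonotoneIn U f
no-outZeros⇒monotone []      f none = tt
no-outZeros⇒monotone (u ∷ U) f none = first , (λ b → no-outZeros⇒monotone U (λ w → f (b ∷ w))
  (λ x fx → ℕₚ.m+n≡0⇒n≡0 (upZero u b (f (true ∷ x))) (none (b ∷ x) fx)))
  where
  nonzero : ∀ b → isZero b ≡ 0 → b ≡ true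
  nonzero true _ = refl
  first : u ≡ true → (λ w → f (false ∷ w)) ⊑ (λ w → f (true ∷ w))
  first refl w with f (false ∷ w) | none (false ∷ w)
  ... | false | _ = Boolₚ.≤-minimum _
  ... | true  | h = Boolₚ.≤-reflexive (sym (nonzero _ (ℕₚ.m+n≡0⇒m≡0 (isZero (f (true ∷ w))) (h refl))))

MonotoneIn-const : ∀ {d} (U : Cube d) b → MonotoneIn U (λ _ → b)
MonotoneIn-const []      b = tt
MonotoneIn-const (u ∷ U) b = (λ _ _ → Boolₚ.≤-refl) , (λ _ → MonotoneIn-const U b)

-- A function without violated edges in U approximates itself. Otherwise one point contributes at
-- least 1 to the sum over the cube that defines the energy, and a constant function is close
-- enough.
approximable-pow2 : ∀ d → Approximable d (pow2 d)
approximable-pow2 d U f = choose (search {P = λ x → f x ≡ true → outZeros U f x ≡ 0} {Q = λ x → f x ≡ true × 1 ℕ.≤ outZeros U f x} decide)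
  where
  decide : ∀ x → (f x ≡ true → outZeros U f x ≡ 0) ⊎ (f x ≡ true × 1 ℕ.≤ outZeros U f x)
  decide x with f x | outZeros U f x
  ... | false | _     = inj₁ λ ()
  ... | true  | zero  = inj₁ λ _ → refl
  ... | true  | suc n = inj₂ (refl , s≤s z≤n)
  choose : (∀ x → f x ≡ true → outZeros U f x ≡ 0) ⊎ (∃ λ x → f x ≡ true × 1 ℕ.≤ outZeros U f x) →
    ∃ λ G → MonotoneIn U G × dist f G ≤ pow2 d * energy U f
  choose (inj₁ none) = f , no-outZeros⇒monotone U f none ,
    subst (_≤ pow2 d * energy U f) (sym (dist-refl f)) (0≤p*q (pow2-nonNeg d) (energy-nonNeg U f))
  choose (inj₂ (x , fx , 1≤n)) = (λ _ → true) , MonotoneIn-const U true , (begin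
    dist f (λ _ → true)                ≤⟨ 𝔼-≤const (λ y → ι≤1 (f y xor true)) ⟩
    1ℚ                                 ≤⟨ root-mono {1} 1≤n ⟩
    root (outZeros U f x)              ≡⟨ sym (ℚₚ.*-identityˡ _) ⟩
    1ℚ * root (outZeros U f x)         ≡⟨ cong (λ b → ι b * root (outZeros U f x)) (sym fx) ⟩
    ι (f x) * root (outZeros U f x)    ≤⟨ point≤𝔼 (λ y → 0≤p*q (ι-nonNeg (f y)) (root-nonNeg (outZeros U f y))) x ⟩
    pow2 d * energy U f                ∎)
    where open ℚₚ.≤-Reasoning

-- Iteration to an absolute constant

approximable-weaken : ∀ {d K K′} → K ≤ K′ → Approximable d K → Approximable d K′
approximable-weaken {d} {K} {K′} K≤K′ approx U f with approx U f
... | G , mono , dist≤ = G , mono , ℚₚ.≤-trans dist≤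
  (*-monoʳ (energy-nonNeg U f))
  where
  *-monoʳ : ∀ {e} → 0ℚ ≤ e → K * e ≤ K′ * e
  *-monoʳ {e} 0≤e = ℚₚ.*-monoʳ-≤-nonNeg e {{ℚ.nonNegative 0≤e}} K≤K′

-- The fixed point of K ↦ 27/32 * K + 28.
limit : ℚ
limit = + 896 / 5

0≤limit : 0ℚ ≤ limit
0≤limit = toWitness {a? = 0ℚ ℚₚ.≤? limit} _

approximable-contract : ∀ {d} c → 0ℚ ≤ c → Approximable d (c + limit) → Approximable d (27/32 * c + limit)
approximable-contract {d} c 0≤c approx = subst (Approximable d) (lem c) (approximable-step (0≤p+q 0≤c 0≤limit) approx)
  where
  lem : ∀ c → 27/32 * (c + limit) + fromℕ 28 ≡ 27/32 * c + limit
  lem = solve-∀ ℚ-ring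

-- Five contractions multiply the excess over `limit` by `(27/32)⁵ < ½`, while four would not
-- suffice. Hence m rounds bring it from `pow2 m` down to 1.
approximable-descend : ∀ {d} m → Approximable d (pow2 m + limit) → Approximable d (1ℚ + limit)
approximable-descend zero    approx = approx
approximable-descend {d} (suc m) approx = approximable-descend m (approximable-weaken shrink (iterate 5 approx))
  where
  c : ℕ → ℚ
  c zero    = pow2 (suc m)
  c (suc n) = 27/32 * c n
  0≤27/32 : 0ℚ ≤ 27/32
  0≤27/32 = toWitness {a? = 0ℚ ℚₚ.≤? 27/32} _
  0≤c : ∀ n → 0ℚ ≤ c n
  0≤c zero    = pow2-nonNeg (suc m)
  0≤c (suc n) = 0≤p*q 0≤27/32 (0≤c n)
  iterate : ∀ n → Approximable d (c 0 + limit) → Approximable d (c n + limit)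
  iterate zero    approx = approx
  iterate (suc n) approx = approximable-contract (c n) (0≤c n) (iterate n approx)
  ratio : ℚ
  ratio = 27/32 * (27/32 * (27/32 * (27/32 * (27/32 * 2ℚ))))
  assoc : ∀ k t p → k * (k * (k * (k * (k * (t * p))))) ≡ k * (k * (k * (k * (k * t)))) * p
  assoc = solve-∀ ℚ-ring
  lem : ∀ r p → p ≡ r * p + (1ℚ - r) * p
  lem = solve-∀ ℚ-ring
  shrink : c 5 + limit ≤ pow2 m + limit
  shrink = ℚₚ.+-monoˡ-≤ limit (ℚₚ.≤-trans (ℚₚ.≤-reflexive (assoc 27/32 2ℚ (pow2 m))) (≤-from-diff (lem ratio (pow2 m))
    (0≤p*q (toWitness {a? = 0ℚ ℚₚ.≤? 1ℚ - ratio} _) (pow2-nonNeg m))))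

full : ∀ d → Cube d
full d = replicate d true

boolean-approximation : ∀ {d} (f : Cube d → Bool) → ∃ λ G → MonotoneIn (full d) G × dist f G ≤ (+ 181 / 1) * energy (full d) f
-- Here `1 + 896/5 = 180.2`, rounded up.
boolean-approximation {d} f = approximable-weaken (toWitness {a? = 1ℚ + limit ℚₚ.≤? (+ 181 / 1)} _)
  (approximable-descend d (approximable-weaken {K = pow2 d} {K′ = pow2 d + limit} (≤-from-diff refl 0≤limit) (approximable-pow2 d))) (full d) f

MonotoneIn-full : ∀ {d} {G : Cube d → Bool} → MonotoneIn (full d) G → ∀ {x y} → x ⪯ y → G x B.≤ G y
MonotoneIn-full {zero}  _ [] = Boolₚ.≤-refl
MonotoneIn-full {suc d} (_ , Gs) (B.b≤b {b} ∷ p) = MonotoneIn-full (Gs b) p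
MonotoneIn-full {suc d} (G₀₁ , Gs) (_∷_ {x = false} {y = true} B.f≤t p) =
  Boolₚ.≤-trans (G₀₁ refl _) (MonotoneIn-full (Gs true) p)

-- From Boolean to rational values

sumℕ : ∀ {d} → (Cube d → ℕ) → ℕ
sumℕ {zero}  k = k []
sumℕ {suc d} k = sumℕ (λ x → k (false ∷ x)) ℕ.+ sumℕ (λ x → k (true ∷ x))

fromℕ-sumℕ : ∀ {d} (k : Cube d → ℕ) → fromℕ (sumℕ k) ≡ pow2 d * 𝔼 (λ x → fromℕ (k x))
fromℕ-sumℕ {zero}  k = sym (ℚₚ.*-identityˡ _)
fromℕ-sumℕ {suc d} k = trans (fromℕ-+ (sumℕ (λ x → k (false ∷ x))) (sumℕ (λ x → k (true ∷ x))))
  (trans (cong₂ _+_ (fromℕ-sumℕ (λ x → k (false ∷ x))) (fromℕ-sumℕ (λ x → k (true ∷ x)))) (lem (pow2 d) _ _))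
  where
  lem : ∀ k p q → k * p + k * q ≡ 2ℚ * k * (½ * (p + q))
  lem = solve-∀ ℚ-ring

pow2-pos : ∀ d → 0ℚ < pow2 d
pow2-pos zero    = toWitness {a? = 0ℚ ℚₚ.<? 1ℚ} _
pow2-pos (suc d) = subst (_< 2ℚ * pow2 d) (ℚₚ.*-zeroʳ 2ℚ) (ℚₚ.*-monoʳ-<-pos 2ℚ (pow2-pos d))

-- Turns a strict decrease of averages into one of natural numbers, so that the later descent
-- terminates.
sumℕ-reflects-< : ∀ {d} (k l : Cube d → ℕ) → 𝔼 (λ x → fromℕ (k x)) < 𝔼 (λ x → fromℕ (l x)) → sumℕ k ℕ.< sumℕ l
sumℕ-reflects-< {d} k l 𝔼k<𝔼l with sumℕ k ℕ.<? sumℕ l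
... | yes lt = lt
... | no ¬lt = ⊥-elim (ℚₚ.<-irrefl refl (ℚₚ.<-≤-trans 𝔼k<𝔼l
  (*-cancelˡ (pow2-pos d) (subst₂ _≤_ (fromℕ-sumℕ l) (fromℕ-sumℕ k) (fromℕ-mono (ℕₚ.≮⇒≥ ¬lt))))))

sumℕ-mono : ∀ {d} {k l : Cube d → ℕ} → (∀ x → k x ℕ.≤ l x) → sumℕ k ℕ.≤ sumℕ l
sumℕ-mono {zero}  k≤l = k≤l []
sumℕ-mono {suc d} k≤l = ℕₚ.+-mono-≤ (sumℕ-mono (λ x → k≤l (false ∷ x))) (sumℕ-mono (λ x → k≤l (true ∷ x)))

sumℕ-mono-< : ∀ {d} {k l : Cube d → ℕ} → (∀ x → k x ℕ.≤ l x) → ∀ x → k x ℕ.< l x → sumℕ k ℕ.< sumℕ l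
sumℕ-mono-< {zero}  k≤l [] lt = lt
sumℕ-mono-< {suc d} k≤l (false ∷ x) lt =
  ℕₚ.+-mono-<-≤ (sumℕ-mono-< (λ x → k≤l (false ∷ x)) x lt) (sumℕ-mono (λ x → k≤l (true ∷ x)))
sumℕ-mono-< {suc d} k≤l (true ∷ x) lt =
  ℕₚ.+-mono-≤-< (sumℕ-mono (λ x → k≤l (false ∷ x))) (sumℕ-mono-< (λ x → k≤l (true ∷ x)) x lt)

term≤sumℕ : ∀ {d} (k : Cube d → ℕ) x → k x ℕ.≤ sumℕ k
term≤sumℕ {zero}  k [] = ℕₚ.≤-refl
term≤sumℕ {suc d} k (false ∷ x) = ℕₚ.≤-trans (term≤sumℕ (λ y → k (false ∷ y)) x) (ℕₚ.m≤m+n _ _)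
term≤sumℕ {suc d} k (true ∷ x)  = ℕₚ.≤-trans (term≤sumℕ (λ y → k (true ∷ y)) x) (ℕₚ.m≤n+m _ (sumℕ (λ y → k (false ∷ y))))

⪯-refl : ∀ {d} (x : Cube d) → x ⪯ x
⪯-refl []      = []
⪯-refl (b ∷ x) = Boolₚ.≤-refl ∷ ⪯-refl x

-- Only points above x are consulted, so a comparison there suffices; the functions compared may
-- thus depend on x.
outZeros-antitone : ∀ {d} (f g : Cube d → Bool) x → (∀ y → x ⪯ y → f y B.≤ g y) → outZeros (full d) g x ℕ.≤ outZeros (full d) f x
outZeros-antitone {zero}  f g []       f≤g = z≤n
outZeros-antitone {suc d} f g (b ∷ x) f≤g = ℕₚ.+-mono-≤ (up b f≤g)
  (outZeros-antitone (λ w → f (b ∷ w)) (λ w → g (b ∷ w)) x (λ y x⪯y → f≤g (b ∷ y) (Boolₚ.≤-refl ∷ x⪯y)))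
  where
  isZero-antitone : ∀ {a b} → a B.≤ b → isZero b ℕ.≤ isZero a
  isZero-antitone B.f≤t = z≤n
  isZero-antitone B.b≤b = ℕₚ.≤-refl
  up : ∀ b → (∀ y → (b ∷ x) ⪯ y → f y B.≤ g y) → upZero true b (g (true ∷ x)) ℕ.≤ upZero true b (f (true ∷ x))
  up true  _   = z≤n
  up false f≤g = isZero-antitone (f≤g (true ∷ x) (B.f≤t ∷ ⪯-refl x))

outZeros-true : ∀ {d} (x : Cube d) → outZeros (full d) (λ _ → true) x ≡ 0
outZeros-true []          = refl
outZeros-true (false ∷ x) = outZeros-true x
outZeros-true (true ∷ x)  = outZeros-true x

-- Moving part of a level by one unit

∣m-1+n∣≤1+∣m-n∣ : ∀ m n → ℕ.∣ m - suc n ∣ ℕ.≤ suc ℕ.∣ m - n ∣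
∣m-1+n∣≤1+∣m-n∣ zero    n       = ℕₚ.≤-refl
∣m-1+n∣≤1+∣m-n∣ (suc m) zero    = ℕₚ.≤-trans (ℕₚ.≤-reflexive (ℕₚ.∣-∣-identityʳ m)) (ℕₚ.m≤n+m m 2)
∣m-1+n∣≤1+∣m-n∣ (suc m) (suc n) = ∣m-1+n∣≤1+∣m-n∣ m n

∣m-n∣≤1+∣m-1+n∣ : ∀ m n → ℕ.∣ m - n ∣ ℕ.≤ suc ℕ.∣ m - suc n ∣
∣m-n∣≤1+∣m-1+n∣ zero    n       = ℕₚ.m≤n+m n 2
∣m-n∣≤1+∣m-1+n∣ (suc m) zero    = s≤s (ℕₚ.≤-reflexive (sym (ℕₚ.∣-∣-identityʳ m)))
∣m-n∣≤1+∣m-1+n∣ (suc m) (suc n) = ∣m-n∣≤1+∣m-1+n∣ m n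

n<m⇒1+∣m-1+n∣≡∣m-n∣ : ∀ {m n} → n ℕ.< m → suc ℕ.∣ m - suc n ∣ ≡ ℕ.∣ m - n ∣
n<m⇒1+∣m-1+n∣≡∣m-n∣ {suc m} {zero}  _         = cong suc (ℕₚ.∣-∣-identityʳ m)
n<m⇒1+∣m-1+n∣≡∣m-n∣ {suc m} {suc n} (s≤s n<m) = n<m⇒1+∣m-1+n∣≡∣m-n∣ n<m

m≤n⇒1+∣m-n∣≡∣m-1+n∣ : ∀ {m n} → m ℕ.≤ n → suc ℕ.∣ m - n ∣ ≡ ℕ.∣ m - suc n ∣
m≤n⇒1+∣m-n∣≡∣m-1+n∣ {zero}          _         = refl
m≤n⇒1+∣m-n∣≡∣m-1+n∣ {suc m} {suc n} (s≤s m≤n) = m≤n⇒1+∣m-n∣≡∣m-1+n∣ m≤n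

-- The cut equal to 1 above the level t, to 0 below it and to c on it. Passing decisions as
-- arguments, here and below, lets proofs proceed by cases on them.
threshold : ∀ {t h : ℕ} → Dec (t ℕ.< h) → Dec (h ≡ t) → Bool → Bool
threshold a e c = does a ∨ (does e ∧ c)

-- As `hx ≤ hy`, leaving or entering the level can only increase the cut; a drop must occur between
-- two points of the level.
threshold-violation : ∀ {t hx hy} (ax : Dec (t ℕ.< hx)) (ex : Dec (hx ≡ t)) (ay : Dec (t ℕ.< hy)) (ey : Dec (hy ≡ t)) {cx cy} →
  hx ℕ.≤ hy → threshold ax ex cx ≡ true → threshold ay ey cy ≡ false → hx ≡ t × cx ≡ true × cy ≡ false
threshold-violation (yes t<hx) _ (no t≮hy) _ hx≤hy _ _ = ⊥-elim (t≮hy (ℕₚ.<-≤-trans t<hx hx≤hy))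
threshold-violation (no _) (yes refl) (no _) (yes refl) hx≤hy p q = refl , p , q
threshold-violation (no _) (yes refl) (no t≮hy) (no hy≢t) hx≤hy _ _ =
  ⊥-elim (hy≢t (ℕₚ.≤-antisym (ℕₚ.≮⇒≥ t≮hy) hx≤hy))
threshold-violation (no _) (no _) _ _ _ () _
threshold-violation (yes _) _ (yes _) _ _ _ ()

raise : ∀ {h t : ℕ} → Dec (h ≡ t) → Bool → ℕ
raise {h} {t} e b = if does e ∧ b then suc t else h

-- At t = 0 the predecessor is 0 and nothing moves, which is harmless since no value lies below 0.
lower : ∀ {h t : ℕ} → Dec (h ≡ t) → Bool → ℕ
lower {h} {t} e b = if does e ∧ not b then ℕ.pred t else h

-- Heights are integers: a point above the level has height at least t + 1, and within the level the
-- raised part is closed upwards.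
raise-mono : ∀ {t hx hy} (ex : Dec (hx ≡ t)) (ey : Dec (hy ≡ t)) {bx by} → hx ℕ.≤ hy → bx B.≤ by → raise ex bx ℕ.≤ raise ey by
raise-mono (no _)     (no _)     le _ = le
raise-mono (no _)     (yes refl) {by = false} le _ = le
raise-mono (no _)     (yes refl) {by = true}  le _ = ℕₚ.m≤n⇒m≤1+n le
raise-mono (yes refl) (no _)     {bx = false} le _ = le
raise-mono (yes refl) (no hy≢t)  {bx = true}  le _ = ℕₚ.≤∧≢⇒< le (λ t≡hy → hy≢t (sym t≡hy))
raise-mono (yes refl) (yes refl) {bx = false} {by = false} _ _ = ℕₚ.≤-refl
raise-mono (yes refl) (yes refl) {bx = false} {by = true}  _ _ = ℕₚ.n≤1+n _
raise-mono (yes refl) (yes refl) {bx = true}  {by = true}  _ _ = ℕₚ.≤-refl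

lower-mono : ∀ {t hx hy} (ex : Dec (hx ≡ t)) (ey : Dec (hy ≡ t)) {bx by} → hx ℕ.≤ hy → bx B.≤ by → lower ex bx ℕ.≤ lower ey by
lower-mono (no _)     (no _)     le _ = le
lower-mono (no hx≢t)  (yes refl) {by = false} le _ = ℕₚ.<⇒≤pred (ℕₚ.≤∧≢⇒< le hx≢t)
lower-mono (no _)     (yes refl) {by = true}  le _ = le
lower-mono (yes refl) (no _)     {bx = false} le _ = ℕₚ.≤-trans ℕₚ.pred[n]≤n le
lower-mono (yes refl) (no _)     {bx = true}  le _ = le
lower-mono (yes refl) (yes refl) {bx = false} {by = false} _ _ = ℕₚ.≤-refl
lower-mono (yes refl) (yes refl) {bx = false} {by = true}  _ _ = ℕₚ.pred[n]≤n
lower-mono (yes refl) (yes refl) {bx = true}  {by = true}  _ _ = ℕₚ.≤-refl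

fromℕ+0≤ : ∀ {m q} → 0ℚ ≤ q → fromℕ m + 0ℚ ≤ fromℕ m + q
fromℕ+0≤ {m} 0≤q = ℚₚ.+-monoʳ-≤ (fromℕ m) 0≤q

fromℕ+1≤+0 : ∀ {m n} → suc m ≡ n → fromℕ m + 1ℚ ≤ fromℕ n + 0ℚ
fromℕ+1≤+0 {m} refl = ℚₚ.≤-reflexive (trans (ℚₚ.+-comm (fromℕ m) 1ℚ) (sym (ℚₚ.+-identityʳ (1ℚ + fromℕ m))))

fromℕ+0≤+1 : ∀ {m n} → m ℕ.≤ suc n → fromℕ m + 0ℚ ≤ fromℕ n + 1ℚ
fromℕ+0≤+1 {m} {n} le = ℚₚ.≤-trans (ℚₚ.≤-reflexive (ℚₚ.+-identityʳ (fromℕ m)))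
  (ℚₚ.≤-trans (fromℕ-mono le) (ℚₚ.≤-reflexive (ℚₚ.+-comm 1ℚ (fromℕ n))))

-- On the level, raising where ρ > t gains one unit. A missed gain (b = 0 and ρ > t) or a loss (b =
-- 1 and ρ ≤ t) is one unit, paid for by the disagreement of b with the cut.
raise-cost : ∀ {ρ h t} (a : Dec (t ℕ.< h)) (e : Dec (h ≡ t)) (l : Dec (t ℕ.< ρ)) b →
  fromℕ ℕ.∣ ρ - raise e b ∣ + ι (does e ∧ does l) ≤ fromℕ ℕ.∣ ρ - h ∣ + neq (threshold a e (does l)) b
raise-cost {ρ} {h} a (no _) l b = fromℕ+0≤ {ℕ.∣ ρ - h ∣} (ι-nonNeg ((does a ∨ false) xor b))
raise-cost (yes t<t) (yes refl) l b = ⊥-elim (ℕₚ.<-irrefl refl t<t)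
raise-cost (no _) (yes refl) (yes t<ρ) true  = fromℕ+1≤+0 (n<m⇒1+∣m-1+n∣≡∣m-n∣ t<ρ)
raise-cost (no _) (yes refl) (yes t<ρ) false = ℚₚ.≤-refl
raise-cost {ρ} {h} (no _) (yes refl) (no t≮ρ) true = fromℕ+0≤+1 {ℕ.∣ ρ - suc h ∣} (∣m-1+n∣≤1+∣m-n∣ ρ h)
raise-cost (no _) (yes refl) (no t≮ρ) false = ℚₚ.≤-refl

lower-cost : ∀ {ρ h t} (a : Dec (t ℕ.< h)) (e : Dec (h ≡ t)) (l : Dec (ρ ℕ.< t)) (m : Dec (t ℕ.≤ ρ)) b →
  fromℕ ℕ.∣ ρ - lower e b ∣ + ι (does e ∧ does l) ≤ fromℕ ℕ.∣ ρ - h ∣ + neq (threshold a e (does m)) b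
lower-cost {ρ} {h} a (no _) l m b = fromℕ+0≤ {ℕ.∣ ρ - h ∣} (ι-nonNeg ((does a ∨ false) xor b))
lower-cost (yes t<t) (yes refl) l m b = ⊥-elim (ℕₚ.<-irrefl refl t<t)
lower-cost (no _) (yes refl) (yes ρ<t) (yes t≤ρ) b = ⊥-elim (ℕₚ.<⇒≱ ρ<t t≤ρ)
lower-cost (no _) (yes refl) (no ρ≮t) (no t≰ρ) b = ⊥-elim (ρ≮t (ℕₚ.≰⇒> t≰ρ))
lower-cost (no _) (yes refl) (yes ρ<t) (no _) true  = ℚₚ.≤-refl
lower-cost {h = suc h} (no _) (yes refl) (yes (s≤s ρ≤h)) (no _) false = fromℕ+1≤+0 (m≤n⇒1+∣m-n∣≡∣m-1+n∣ ρ≤h)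
lower-cost (no _) (yes refl) (no _) (yes t≤ρ) true = ℚₚ.≤-refl
lower-cost {ρ} {zero} (no _) (yes refl) (no _) (yes t≤ρ) false = fromℕ+0≤+1 {ℕ.∣ ρ - 0 ∣} (ℕₚ.n≤1+n _)
lower-cost {ρ} {suc h} (no _) (yes refl) (no _) (yes t≤ρ) false = fromℕ+0≤+1 {ℕ.∣ ρ - h ∣} (∣m-n∣≤1+∣m-1+n∣ ρ h)

-- Sums over levels

sumTo : ℕ → (ℕ → ℚ) → ℚ
sumTo zero    F = 0ℚ
sumTo (suc n) F = sumTo n F + F n

sumTo-mono : ∀ n {F G : ℕ → ℚ} → (∀ t → t ℕ.< n → F t ≤ G t) → sumTo n F ≤ sumTo n G
sumTo-mono zero    F≤G = ℚₚ.≤-refl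
sumTo-mono (suc n) F≤G = ℚₚ.+-mono-≤ (sumTo-mono n (λ t t<n → F≤G t (ℕₚ.m≤n⇒m≤1+n t<n))) (F≤G n ℕₚ.≤-refl)

sumTo-* : ∀ n c (F : ℕ → ℚ) → sumTo n (λ t → c * F t) ≡ c * sumTo n F
sumTo-* zero    c F = sym (ℚₚ.*-zeroʳ c)
sumTo-* (suc n) c F = trans (cong (λ h → h + c * F n) (sumTo-* n c F)) (sym (ℚₚ.*-distribˡ-+ c (sumTo n F) (F n)))

𝔼-sumTo : ∀ {d} n (F : ℕ → Cube d → ℚ) → 𝔼 (λ x → sumTo n (λ t → F t x)) ≡ sumTo n (λ t → 𝔼 (F t))
𝔼-sumTo {d} zero F = 𝔼-const d 0ℚ
𝔼-sumTo (suc n)  F = trans (𝔼-+ (λ x → sumTo n (λ t → F t x)) (F n)) (cong (λ h → h + 𝔼 (F n)) (𝔼-sumTo n F))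

sumTo-zero : ∀ n {F : ℕ → ℚ} → (∀ t → t ℕ.< n → F t ≡ 0ℚ) → sumTo n F ≡ 0ℚ
sumTo-zero zero    F≡0 = refl
sumTo-zero (suc n) F≡0 = cong₂ _+_ (sumTo-zero n (λ t t<n → F≡0 t (ℕₚ.m≤n⇒m≤1+n t<n))) (F≡0 n ℕₚ.≤-refl)

sumTo-single : ∀ n {F : ℕ → ℚ} h → h ℕ.< n → (∀ t → t ≢ h → F t ≡ 0ℚ) → sumTo n F ≡ F h
sumTo-single (suc n) {F} h h<1+n F≡0 with h ℕ.≟ n
... | yes refl = trans (cong (λ k → k + F h) (sumTo-zero n (λ t t<n → F≡0 t (ℕₚ.<⇒≢ t<n)))) (ℚₚ.+-identityˡ (F h))
... | no h≢n   = trans (cong₂ _+_ (sumTo-single n h (ℕₚ.≤∧≢⇒< (ℕₚ.≤-pred h<1+n) h≢n) F≡0) (F≡0 n (λ n≡h → h≢n (sym n≡h))))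
  (ℚₚ.+-identityʳ (F h))

searchℕ : ∀ {P : ℕ → Set} {Q : Set} n → (∀ t → P t ⊎ Q) → (∀ t → t ℕ.< n → P t) ⊎ Q
searchℕ zero P⊎Q = inj₁ λ _ ()
searchℕ {P} (suc n) P⊎Q with searchℕ n P⊎Q | P⊎Q n
... | inj₂ q | _      = inj₂ q
... | inj₁ _ | inj₂ q = inj₂ q
... | inj₁ p | inj₁ pₙ = inj₁ λ t t<1+n → below t (ℕₚ.m<1+n⇒m<n∨m≡n t<1+n)
  where
  below : ∀ t → t ℕ.< n ⊎ t ≡ n → P t
  below t (inj₁ t<n)  = p t t<n
  below t (inj₂ refl) = pₙ

-- Isotonic regression in the ℓ₁-distance

isTrue? : ∀ b → b ≡ true ⊎ b ≡ false
isTrue? true  = inj₁ refl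
isTrue? false = inj₂ refl

does-true : ∀ {P : Set} (p? : Dec P) → does p? ≡ true → P
does-true (yes p) _ = p

does-false : ∀ {P : Set} (p? : Dec P) → does p? ≡ false → ¬ P
does-false (no ¬p) _ = ¬p

ι-does-∧ : ∀ {P : Set} (p? : Dec P) b → P → ι (does p? ∧ b) ≡ ι b
ι-does-∧ (yes _) b _ = refl
ι-does-∧ (no ¬p) b p = ⊥-elim (¬p p)

ι-does-∧-¬ : ∀ {P : Set} (p? : Dec P) b → ¬ P → ι (does p? ∧ b) ≡ 0ℚ
ι-does-∧-¬ (yes p) b ¬p = ⊥-elim (¬p p)
ι-does-∧-¬ (no _)  b _  = refl

ι-does : ∀ {P : Set} (p? : Dec P) → P → ι (does p?) ≡ 1ℚ
ι-does (yes _) _ = refl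
ι-does (no ¬p) p = ⊥-elim (¬p p)

ι-does-¬ : ∀ {P : Set} (p? : Dec P) → ¬ P → ι (does p?) ≡ 0ℚ
ι-does-¬ (yes p) ¬p = ⊥-elim (¬p p)
ι-does-¬ (no _)  _  = refl

-- The number of upper neighbours with smaller ρ, written through `outZeros` so that
-- `outZeros-antitone` can compare it with other counts.
violations : ∀ {d} → (Cube d → ℕ) → Cube d → ℕ
violations {d} ρ x = outZeros (full d) (λ y → does (ρ x ℕ.≤? ρ y)) x

module Regression {d} {K : ℚ} (0≤K : 0ℚ ≤ K) (ρ : Cube d → ℕ)
  (approximate : ∀ (f : Cube d → Bool) → ∃ λ G → MonotoneIn (full d) G × dist f G ≤ K * energy (full d) f) where

  Isotone : (Cube d → ℕ) → Set
  Isotone h = ∀ {x y} → x ⪯ y → h x ℕ.≤ h y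

  levelEnergy : (Cube d → ℕ) → ℕ → ℚ
  levelEnergy h t = 𝔼 (λ x → ι (does (h x ℕ.≟ t)) * root (violations ρ x))

  cut : (Cube d → ℕ) → ℕ → (Cube d → Bool) → Cube d → Bool
  cut h t c x = threshold (t ℕ.<? h x) (h x ℕ.≟ t) (c x)

  -- The hypothesis on c covers both cuts, t < ρ and t ≤ ρ. Violated edges of the cut stay in the
  -- level and run from larger to smaller ρ.
  energy-cut : ∀ {h} → Isotone h → ∀ t c → (∀ x y → c x ≡ true → c y ≡ false → ρ y ℕ.< ρ x) →
    energy (full d) (cut h t c) ≤ levelEnergy h t
  energy-cut {h} iso t c decreasing = 𝔼-mono bound
    where
    F = cut h t c
    violated : ∀ {x y} → x ⪯ y → F x ≡ true → F y ≡ false → h x ≡ t × c x ≡ true × c y ≡ false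
    violated {x} {y} x⪯y = threshold-violation (t ℕ.<? h x) (h x ℕ.≟ t) (t ℕ.<? h y) (h y ℕ.≟ t) (iso x⪯y)
    inside : ∀ x → F x ≡ true → outZeros (full d) F x ℕ.≤ violations ρ x
    inside x Fx = outZeros-antitone (λ y → does (ρ x ℕ.≤? ρ y)) F x step
      where
      step : ∀ y → x ⪯ y → does (ρ x ℕ.≤? ρ y) B.≤ F y
      step y x⪯y with isTrue? (F y)
      ... | inj₁ Fy = subst (does (ρ x ℕ.≤? ρ y) B.≤_) (sym Fy) (Boolₚ.≤-maximum _)
      ... | inj₂ Fy with violated x⪯y Fx Fy | isTrue? (does (ρ x ℕ.≤? ρ y))
      ...   | _ , cx , cy | inj₁ le = ⊥-elim (ℕₚ.<⇒≱ (decreasing x y cx cy) (does-true (ρ x ℕ.≤? ρ y) le))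
      ...   | _           | inj₂ eq = subst (B._≤ F y) (sym eq) (Boolₚ.≤-minimum _)
    outside : ∀ x → F x ≡ true → h x ≢ t → outZeros (full d) F x ℕ.≤ 0
    outside x Fx hx≢t = subst (outZeros (full d) F x ℕ.≤_) (outZeros-true x) (outZeros-antitone (λ _ → true) F x step)
      where
      step : ∀ y → x ⪯ y → true B.≤ F y
      step y x⪯y with isTrue? (F y)
      ... | inj₁ Fy = Boolₚ.≤-reflexive (sym Fy)
      ... | inj₂ Fy = ⊥-elim (hx≢t (proj₁ (violated x⪯y Fx Fy)))
    bound : ∀ x → ι (F x) * root (outZeros (full d) F x) ≤ ι (does (h x ℕ.≟ t)) * root (violations ρ x)
    bound x = go (isTrue? (F x)) (h x ℕ.≟ t)
      where
      open ℚₚ.≤-Reasoning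
      go : F x ≡ true ⊎ F x ≡ false → (e : Dec (h x ≡ t)) → ι (F x) * root (outZeros (full d) F x) ≤ ι (does e) * root (violations ρ x)
      go (inj₂ Fx) e = begin
        ι (F x) * root (outZeros (full d) F x) ≡⟨ cong (λ b → ι b * root (outZeros (full d) F x)) Fx ⟩
        0ℚ * root (outZeros (full d) F x)      ≡⟨ ℚₚ.*-zeroˡ (root (outZeros (full d) F x)) ⟩
        0ℚ                                     ≤⟨ 0≤p*q (ι-nonNeg (does e)) (root-nonNeg (violations ρ x)) ⟩
        ι (does e) * root (violations ρ x)       ∎
      go (inj₁ Fx) (yes _) = *-mono (ι-nonNeg (F x)) (ι≤1 (F x)) (root-nonNeg (outZeros (full d) F x)) (root-mono (inside x Fx))
      go (inj₁ Fx) (no hx≢t) = begin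
        ι (F x) * root (outZeros (full d) F x) ≤⟨ *-monoˡ (ι-nonNeg (F x)) (root-mono (outside x Fx hx≢t)) ⟩
        ι (F x) * 0ℚ                           ≡⟨ ℚₚ.*-zeroʳ (ι (F x)) ⟩
        0ℚ                                     ≡⟨ sym (ℚₚ.*-zeroˡ (root (violations ρ x))) ⟩
        0ℚ * root (violations ρ x)               ∎

  cost : (Cube d → ℕ) → Cube d → ℕ
  cost h x = ℕ.∣ ρ x - h x ∣

  Improvable : (Cube d → ℕ) → Set
  Improvable h = ∃ λ h′ → Isotone h′ × sumℕ (cost h′) ℕ.< sumℕ (cost h)

  -- X is the possible gain and D the disagreement of G with the cut; a G with smaller mean
  -- disagreement yields a net gain.
  improve : ∀ {h h′} (X D : Cube d → ℚ) → Isotone h′ →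
    (∀ x → fromℕ (cost h′ x) + X x ≤ fromℕ (cost h x) + D x) → 𝔼 D < 𝔼 X → Improvable h
  improve {h} {h′} X D iso le 𝔼D<𝔼X = h′ , iso , sumℕ-reflects-< (cost h′) (cost h)
    (subst₂ _<_ (lem (𝔼 (λ x → fromℕ (cost h′ x))) (𝔼 X)) (lem (𝔼 (λ x → fromℕ (cost h x))) (𝔼 X)) (ℚₚ.+-monoˡ-< (- 𝔼 X) sum<))
    where
    lem : ∀ p q → p + q - q ≡ p
    lem = solve-∀ ℚ-ring
    sum< : 𝔼 (λ x → fromℕ (cost h′ x)) + 𝔼 X < 𝔼 (λ x → fromℕ (cost h x)) + 𝔼 X
    sum< = ℚₚ.≤-<-trans
      (subst₂ _≤_ (𝔼-+ (λ x → fromℕ (cost h′ x)) X) (𝔼-+ (λ x → fromℕ (cost h x)) D) (𝔼-mono le))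
      (ℚₚ.+-monoʳ-< (𝔼 (λ x → fromℕ (cost h x))) 𝔼D<𝔼X)

  above below : (Cube d → ℕ) → ℕ → Cube d → ℚ
  above h t x = ι (does (h x ℕ.≟ t) ∧ does (t ℕ.<? ρ x))
  below h t x = ι (does (h x ℕ.≟ t) ∧ does (ρ x ℕ.<? t))

  -- If a monotone G were closer to the upper cut than the measure of {h = t < ρ},
  -- then raising h on {h = t} ∩ G would decrease its ℓ₁-distance to ρ.
  above-bound : ∀ {h} → Isotone h → ∀ t → 𝔼 (above h t) ≤ K * levelEnergy h t ⊎ Improvable h
  above-bound {h} iso t with approximate (cut h t (λ x → does (t ℕ.<? ρ x)))
  ... | G , mono , dist≤ with 𝔼 (above h t) ℚₚ.≤? dist (cut h t (λ x → does (t ℕ.<? ρ x))) G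
  ...   | yes le = inj₁ (ℚₚ.≤-trans le (ℚₚ.≤-trans dist≤ (*-monoˡ 0≤K (energy-cut iso t _ decreasing))))
    where
    decreasing : ∀ x y → does (t ℕ.<? ρ x) ≡ true → does (t ℕ.<? ρ y) ≡ false → ρ y ℕ.< ρ x
    decreasing x y p q = ℕₚ.≤-<-trans (ℕₚ.≮⇒≥ (does-false (t ℕ.<? ρ y) q)) (does-true (t ℕ.<? ρ x) p)
  ...   | no ¬le = inj₂ (improve (above h t) (λ x → neq (cut h t (λ x → does (t ℕ.<? ρ x)) x) (G x))
    (λ {x} {y} x⪯y → raise-mono (h x ℕ.≟ t) (h y ℕ.≟ t) (iso x⪯y) (MonotoneIn-full mono x⪯y))
    (λ x → raise-cost (t ℕ.<? h x) (h x ℕ.≟ t) (t ℕ.<? ρ x) (G x)) (ℚₚ.≰⇒> ¬le))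

  -- The mirror image: the cut is t ≤ ρ, and h is lowered on the part of the level outside G.
  below-bound : ∀ {h} → Isotone h → ∀ t → 𝔼 (below h t) ≤ K * levelEnergy h t ⊎ Improvable h
  below-bound {h} iso t with approximate (cut h t (λ x → does (t ℕ.≤? ρ x)))
  ... | G , mono , dist≤ with 𝔼 (below h t) ℚₚ.≤? dist (cut h t (λ x → does (t ℕ.≤? ρ x))) G
  ...   | yes le = inj₁ (ℚₚ.≤-trans le (ℚₚ.≤-trans dist≤ (*-monoˡ 0≤K (energy-cut iso t _ decreasing))))
    where
    decreasing : ∀ x y → does (t ℕ.≤? ρ x) ≡ true → does (t ℕ.≤? ρ y) ≡ false → ρ y ℕ.< ρ x
    decreasing x y p q = ℕₚ.<-≤-trans (ℕₚ.≰⇒> (does-false (t ℕ.≤? ρ y) q)) (does-true (t ℕ.≤? ρ x) p)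
  ...   | no ¬le = inj₂ (improve (below h t) (λ x → neq (cut h t (λ x → does (t ℕ.≤? ρ x)) x) (G x))
    (λ {x} {y} x⪯y → lower-mono (h x ℕ.≟ t) (h y ℕ.≟ t) (iso x⪯y) (MonotoneIn-full mono x⪯y))
    (λ x → lower-cost (t ℕ.<? h x) (h x ℕ.≟ t) (ρ x ℕ.<? t) (t ℕ.≤? ρ x) (G x)) (ℚₚ.≰⇒> ¬le))

  Balanced : (Cube d → ℕ) → ℕ → Set
  Balanced h t = 𝔼 (λ x → above h t x + below h t x) ≤ (K + K) * levelEnergy h t

  balanced? : ∀ {h} → Isotone h → ∀ t → Balanced h t ⊎ Improvable h
  balanced? {h} iso t with above-bound iso t | below-bound iso t
  ... | inj₂ imp | _        = inj₂ imp
  ... | inj₁ _   | inj₂ imp = inj₂ imp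
  ... | inj₁ le₁ | inj₁ le₂ = inj₁ (subst₂ _≤_ (sym (𝔼-+ (above h t) (below h t))) (lem (levelEnergy h t)) (ℚₚ.+-mono-≤ le₁ le₂))
    where
    lem : ∀ e → K * e + K * e ≡ (K + K) * e
    lem e = sym (ℚₚ.*-distribʳ-+ e K K)

  -- A crude bound that exceeds every value of h.
  levels : (Cube d → ℕ) → ℕ
  levels h = suc (sumℕ h)

  -- Descent from the zero function: an unbalanced level supplies an improvement, and each
  -- improvement lowers the integer cost. Only these local moves have to be excluded, not all
  -- competitors.
  optimal : ∃ λ h → Isotone h × (∀ t → t ℕ.< levels h → Balanced h t)
  optimal = search-from (suc (sumℕ (cost (λ _ → 0)))) (λ _ → 0) (λ _ → z≤n) ℕₚ.≤-refl
    where
    search-from : ∀ n h → Isotone h → sumℕ (cost h) ℕ.< n → ∃ λ h → Isotone h × (∀ t → t ℕ.< levels h → Balanced h t)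
    search-from (suc n) h iso (s≤s le) with searchℕ (levels h) (balanced? iso)
    ... | inj₁ balanced          = h , iso , balanced
    ... | inj₂ (h′ , iso′ , lt) = search-from n h′ iso′ (ℕₚ.<-≤-trans lt le)

  -- Every point lies in exactly one level, so the level energies add up to the full average without
  -- loss; `K + K` accounts for the points above and below h.
  isotone-approximation : ∃ λ h → Isotone h ×
    𝔼 (λ x → ι (does (h x ℕ.<? ρ x)) + ι (does (ρ x ℕ.<? h x))) ≤ (K + K) * 𝔼 (λ x → root (violations ρ x))
  isotone-approximation with optimal
  ... | h , iso , balanced = h , iso , (begin
    𝔼 (λ x → ι (does (h x ℕ.<? ρ x)) + ι (does (ρ x ℕ.<? h x)))
      ≡⟨ 𝔼-cong (λ x → sym (collect x)) ⟩
    𝔼 (λ x → sumTo (levels h) (λ t → above h t x + below h t x))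
      ≡⟨ 𝔼-sumTo (levels h) (λ t x → above h t x + below h t x) ⟩
    sumTo (levels h) (λ t → 𝔼 (λ x → above h t x + below h t x))
      ≤⟨ sumTo-mono (levels h) balanced ⟩
    sumTo (levels h) (λ t → (K + K) * levelEnergy h t)
      ≡⟨ sumTo-* (levels h) ((K + K)) (levelEnergy h) ⟩
    (K + K) * sumTo (levels h) (levelEnergy h)
      ≡⟨ cong (λ k → (K + K) * k) (sym (𝔼-sumTo (levels h) (λ t x → ι (does (h x ℕ.≟ t)) * root (violations ρ x)))) ⟩
    (K + K) * 𝔼 (λ x → sumTo (levels h) (λ t → ι (does (h x ℕ.≟ t)) * root (violations ρ x)))
      ≡⟨ cong (λ k → (K + K) * k) (𝔼-cong partition) ⟩
    (K + K) * 𝔼 (λ x → root (violations ρ x)) ∎)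
    where
    open ℚₚ.≤-Reasoning
    h<levels : ∀ x → h x ℕ.< levels h
    h<levels x = s≤s (term≤sumℕ h x)
    collect : ∀ x → sumTo (levels h) (λ t → above h t x + below h t x) ≡ ι (does (h x ℕ.<? ρ x)) + ι (does (ρ x ℕ.<? h x))
    collect x = trans
      (sumTo-single (levels h) (h x) (h<levels x) (λ t t≢h → cong₂ _+_
        (ι-does-∧-¬ (h x ℕ.≟ t) _ (λ eq → t≢h (sym eq))) (ι-does-∧-¬ (h x ℕ.≟ t) _ (λ eq → t≢h (sym eq)))))
      (cong₂ _+_ (ι-does-∧ (h x ℕ.≟ h x) _ refl) (ι-does-∧ (h x ℕ.≟ h x) _ refl))
    partition : ∀ x → sumTo (levels h) (λ t → ι (does (h x ℕ.≟ t)) * root (violations ρ x)) ≡ root (violations ρ x)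
    partition x = trans
      (sumTo-single (levels h) (h x) (h<levels x) (λ t t≢h →
        trans (cong (λ k → k * root (violations ρ x)) (ι-does-¬ (h x ℕ.≟ t) (λ eq → t≢h (sym eq)))) (ℚₚ.*-zeroˡ (root (violations ρ x)))))
      (trans (cong (λ k → k * root (violations ρ x)) (ι-does (h x ℕ.≟ h x) refl)) (ℚₚ.*-identityˡ (root (violations ρ x))))

-- Ranks of rational values

indicator : ∀ {P : Set} → Dec P → ℕ
indicator p? = if does p? then 1 else 0

indicator-mono : ∀ {P Q : Set} (p? : Dec P) (q? : Dec Q) → (P → Q) → indicator p? ℕ.≤ indicator q?
indicator-mono (no _)  q?      _   = z≤n
indicator-mono (yes _) (yes _) _   = ℕₚ.≤-refl
indicator-mono (yes p) (no ¬q) P→Q = ⊥-elim (¬q (P→Q p))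

indicator-< : ∀ {P Q : Set} (p? : Dec P) (q? : Dec Q) → ¬ P → Q → indicator p? ℕ.< indicator q?
indicator-< (yes p) _       ¬p _ = ⊥-elim (¬p p)
indicator-< (no _)  (yes _) _  _ = ℕₚ.≤-refl
indicator-< (no _)  (no ¬q) _  q = ⊥-elim (¬q q)

-- An integer function ordered like f. Violated edges depend on the order alone, while unit shifts
-- and descent require integers.
rank : ∀ {d} → (Cube d → ℚ) → Cube d → ℕ
rank f x = sumℕ (λ y → indicator (f y ℚₚ.<? f x))

module _ {d} (f : Cube d → ℚ) where

  private
    rank-pointwise : ∀ {x y} → f x ≤ f y → ∀ w → indicator (f w ℚₚ.<? f x) ℕ.≤ indicator (f w ℚₚ.<? f y)
    rank-pointwise {x} {y} fx≤fy w = indicator-mono (f w ℚₚ.<? f x) (f w ℚₚ.<? f y) (λ fw<fx → ℚₚ.<-≤-trans fw<fx fx≤fy)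

  rank-mono : ∀ {x y} → f x ≤ f y → rank f x ℕ.≤ rank f y
  rank-mono {x} {y} fx≤fy = sumℕ-mono (rank-pointwise {x} {y} fx≤fy)

  rank-mono-< : ∀ {x y} → f x < f y → rank f x ℕ.< rank f y
  rank-mono-< {x} {y} fx<fy = sumℕ-mono-< (rank-pointwise {x} {y} (ℚₚ.<⇒≤ fx<fy)) x
    (indicator-< (f x ℚₚ.<? f x) (f x ℚₚ.<? f y) (ℚₚ.<-irrefl refl) fx<fy)

  rank-reflects-≤ : ∀ {x y} → rank f x ℕ.≤ rank f y → f x ≤ f y
  rank-reflects-≤ {x} {y} le with f x ℚₚ.≤? f y
  ... | yes fx≤fy = fx≤fy
  ... | no ¬fx≤fy = ⊥-elim (ℕₚ.<⇒≱ (rank-mono-< {y} {x} (ℚₚ.≰⇒> ¬fx≤fy)) le)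

maxCube : ∀ {d} → (Cube d → ℚ) → ℚ
maxCube {zero}  F = F []
maxCube {suc d} F = maxCube (λ x → F (false ∷ x)) ℚ.⊔ maxCube (λ x → F (true ∷ x))

≤maxCube : ∀ {d} (F : Cube d → ℚ) x → F x ≤ maxCube F
≤maxCube {zero}  F []          = ℚₚ.≤-refl
≤maxCube {suc d} F (false ∷ x) = ℚₚ.≤-trans (≤maxCube (λ y → F (false ∷ y)) x) (ℚₚ.p≤p⊔q _ _)
≤maxCube {suc d} F (true ∷ x)  = ℚₚ.≤-trans (≤maxCube (λ y → F (true ∷ y)) x) (ℚₚ.p≤q⊔p (maxCube (λ y → F (false ∷ y))) _)

maxCube-least : ∀ {d} (F : Cube d → ℚ) {c} → (∀ x → F x ≤ c) → maxCube F ≤ c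
maxCube-least {zero}  F F≤c = F≤c []
maxCube-least {suc d} F F≤c = ℚₚ.⊔-lub (maxCube-least (λ x → F (false ∷ x)) (λ x → F≤c (false ∷ x)))
  (maxCube-least (λ x → F (true ∷ x)) (λ x → F≤c (true ∷ x)))

lowerBound : ∀ {d} (F : Cube d → ℚ) → ∃ λ c → ∀ x → c ≤ F x
lowerBound {zero}  F = F [] , λ { [] → ℚₚ.≤-refl }
lowerBound {suc d} F with lowerBound (λ x → F (false ∷ x)) | lowerBound (λ x → F (true ∷ x))
... | a , a≤ | b , b≤ = a ℚ.⊓ b , λ { (false ∷ x) → ℚₚ.≤-trans (ℚₚ.p⊓q≤p a b) (a≤ x) ; (true ∷ x) → ℚₚ.≤-trans (ℚₚ.p⊓q≤q a b) (b≤ x) }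

module _ {d} (f : Cube d → ℚ) where

  private
    bottom = proj₁ (lowerBound f)

    truncated : ℕ → Cube d → ℚ
    truncated k y = if does (rank f y ℕ.≤? k) then f y else bottom

  -- A monotone left inverse of the rank, defined on all of ℕ because the regression may take values
  -- that are not ranks. The default `bottom` is at most every value of f.
  unrank : ℕ → ℚ
  unrank k = maxCube (truncated k)

  unrank-mono : ∀ {k l} → k ℕ.≤ l → unrank k ≤ unrank l
  unrank-mono {k} {l} k≤l = maxCube-least (truncated k) (λ y → ℚₚ.≤-trans (pointwise y) (≤maxCube (truncated l) y))
    where
    select : ∀ {P Q : Set} (p? : Dec P) (q? : Dec Q) {a b} → b ≤ a → (P → Q) → (if does p? then a else b) ≤ (if does q? then a else b)
    select (yes _) (yes _) _   _   = ℚₚ.≤-refl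
    select (yes p) (no ¬q) _   P→Q = ⊥-elim (¬q (P→Q p))
    select (no _)  (yes _) b≤a _   = b≤a
    select (no _)  (no _)  _   _   = ℚₚ.≤-refl
    pointwise : ∀ y → truncated k y ≤ truncated l y
    pointwise y = select (rank f y ℕ.≤? k) (rank f y ℕ.≤? l) (proj₂ (lowerBound f) y) (λ r≤k → ℕₚ.≤-trans r≤k k≤l)

  unrank-rank : ∀ x → unrank (rank f x) ≡ f x
  unrank-rank x = ℚₚ.≤-antisym (maxCube-least (truncated (rank f x)) bounded) (ℚₚ.≤-trans attained (≤maxCube (truncated (rank f x)) x))
    where
    bounded : ∀ y → truncated (rank f x) y ≤ f x
    bounded y = select (rank f y ℕ.≤? rank f x) (rank-reflects-≤ f)
      where
      select : ∀ {P : Set} (p? : Dec P) → (P → f y ≤ f x) → (if does p? then f y else bottom) ≤ f x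
      select (yes p) le = le p
      select (no _)  _  = proj₂ (lowerBound f) x
    attained : f x ≤ truncated (rank f x) x
    attained = select (rank f x ℕ.≤? rank f x) ℕₚ.≤-refl
      where
      select : ∀ {P : Set} (p? : Dec P) → P → f x ≤ (if does p? then f x else bottom)
      select (yes _) _ = ℚₚ.≤-refl
      select (no ¬p) p = ⊥-elim (¬p p)

-- Counts over lists and recursive counts

length-filter-map : ∀ {A B : Set} {P : B → Set} (P? : ∀ y → Dec (P y)) (g : A → B) xs →
  length (filter P? (map g xs)) ≡ length (filter (λ x → P? (g x)) xs)
length-filter-map P? g []       = refl
length-filter-map P? g (x ∷ xs) with does (P? (g x))
... | true  = cong suc (length-filter-map P? g xs)
... | false = length-filter-map P? g xs

length-filter-allCube : ∀ {d} {P : Cube d → Set} (P? : ∀ x → Dec (P x)) →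
  length (filter P? (allCube d)) ≡ sumℕ (λ x → indicator (P? x))
length-filter-allCube {zero} P? with does (P? [])
... | true  = refl
... | false = refl
length-filter-allCube {suc d} P? = begin
  length (filter P? (map (false ∷_) (allCube d) ++ map (true ∷_) (allCube d)))
    ≡⟨ cong length (Listₚ.filter-++ P? (map (false ∷_) (allCube d)) _) ⟩
  length (filter P? (map (false ∷_) (allCube d)) ++ filter P? (map (true ∷_) (allCube d)))
    ≡⟨ Listₚ.length-++ (filter P? (map (false ∷_) (allCube d))) ⟩
  length (filter P? (map (false ∷_) (allCube d))) ℕ.+ length (filter P? (map (true ∷_) (allCube d)))
    ≡⟨ cong₂ ℕ._+_ (face false) (face true) ⟩
  sumℕ (λ x → indicator (P? x)) ∎
  where
  open ≡-Reasoning
  face : ∀ b → length (filter P? (map (b ∷_) (allCube d))) ≡ sumℕ (λ x → indicator (P? (b ∷ x)))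
  face b = trans (length-filter-map P? (b ∷_) (allCube d)) (length-filter-allCube (λ x → P? (b ∷ x)))

sumCube-𝔼 : ∀ {d} (F : Cube d → ℚ) → sumCube F ≡ pow2 d * 𝔼 F
sumCube-𝔼 F = trans (go F 0ℚ) (ℚₚ.+-identityʳ _)
  where
  -- The initial value is generalised, because the fold over the first half starts from the result
  -- of the second.
  go : ∀ {d} (F : Cube d → ℚ) a → foldr (λ x acc → F x + acc) a (allCube d) ≡ pow2 d * 𝔼 F + a
  go {zero}  F a = cong (λ h → h + a) (sym (ℚₚ.*-identityˡ (F [])))
  go {suc d} F a = begin
    foldr (λ x acc → F x + acc) a (map (false ∷_) (allCube d) ++ map (true ∷_) (allCube d))
      ≡⟨ Listₚ.foldr-++ (λ x acc → F x + acc) a (map (false ∷_) (allCube d)) _ ⟩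
    foldr (λ x acc → F x + acc) (foldr (λ x acc → F x + acc) a (map (true ∷_) (allCube d))) (map (false ∷_) (allCube d))
      ≡⟨ Listₚ.foldr-map (λ x acc → F x + acc) (false ∷_) _ (allCube d) ⟩
    foldr (λ x acc → F (false ∷ x) + acc) (foldr (λ x acc → F x + acc) a (map (true ∷_) (allCube d))) (allCube d)
      ≡⟨ go (λ x → F (false ∷ x)) _ ⟩
    pow2 d * p + foldr (λ x acc → F x + acc) a (map (true ∷_) (allCube d))
      ≡⟨ cong (λ h → pow2 d * p + h) (trans (Listₚ.foldr-map (λ x acc → F x + acc) (true ∷_) a (allCube d)) (go (λ x → F (true ∷ x)) a)) ⟩
    pow2 d * p + (pow2 d * q + a)        ≡⟨ lem (pow2 d) p q a ⟩
    2ℚ * pow2 d * (½ * (p + q)) + a      ∎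
    where
    open ≡-Reasoning
    p = 𝔼 (λ x → F (false ∷ x))
    q = 𝔼 (λ x → F (true ∷ x))
    lem : ∀ k p q a → k * p + (k * q + a) ≡ 2ℚ * k * (½ * (p + q)) + a
    lem = solve-∀ ℚ-ring

length-filter-up : ∀ {d} {P : Cube d → Set} (P? : ∀ y → Dec (P y)) (x : Cube d) →
  length (filter (λ i → (lookup x i Boolₚ.≟ false) ×-dec P? (x [ i ]≔ true)) (allFin d)) ≡ outZeros (full d) (λ y → not (does (P? y))) x
length-filter-up P? [] = refl
length-filter-up {suc d} P? (b ∷ x) = begin
  length (filter Q? (zero ∷ tabulate suc))                                   ≡⟨ head b ⟩
  upZero true b (not (does (P? (true ∷ x)))) ℕ.+ length (filter Q? (tabulate suc))
    ≡⟨ cong (λ n → upZero true b (not (does (P? (true ∷ x)))) ℕ.+ n) tail ⟩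
  upZero true b (not (does (P? (true ∷ x)))) ℕ.+ outZeros (full d) (λ y → not (does (P? (b ∷ y)))) x ∎
  where
  open ≡-Reasoning
  Q? : ∀ i → Dec (lookup (b ∷ x) i ≡ false × _)
  Q? i = (lookup (b ∷ x) i Boolₚ.≟ false) ×-dec P? ((b ∷ x) [ i ]≔ true)
  tail : length (filter Q? (tabulate suc)) ≡ outZeros (full d) (λ y → not (does (P? (b ∷ y)))) x
  tail = trans (cong (λ is → length (filter Q? is)) (sym (Listₚ.map-tabulate (λ i → i) suc)))
    (trans (length-filter-map Q? suc (allFin d)) (length-filter-up (λ y → P? (b ∷ y)) x))
  head : ∀ b → length (filter (λ i → (lookup (b ∷ x) i Boolₚ.≟ false) ×-dec P? ((b ∷ x) [ i ]≔ true)) (zero ∷ tabulate suc))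
    ≡ upZero true b (not (does (P? (true ∷ x)))) ℕ.+ length (filter (λ i → (lookup (b ∷ x) i Boolₚ.≟ false) ×-dec P? ((b ∷ x) [ i ]≔ true)) (tabulate suc))
  head true = refl
  head false with does (P? (true ∷ x))
  ... | true  = refl
  ... | false = refl

-- From the regression of ranks to the inequality

monotone-approximation : ∀ {d K} → 0ℚ ≤ K →
  (∀ (f : Cube d → Bool) → ∃ λ G → MonotoneIn (full d) G × dist f G ≤ K * energy (full d) f) →
  ∀ (f : Cube d → ℚ) → ∃ λ g → Monotone g × fromℕ (disagree f g) ≤ pow2 d * ((K + K) * 𝔼 (λ x → root (Iminus f x)))
monotone-approximation {d} {K} 0≤K approximate f = g , (λ x y x⪯y → unrank-mono f (proj₁ (proj₂ regression) x⪯y)) , (begin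
  fromℕ (disagree f g)
    ≡⟨ cong fromℕ (length-filter-allCube (λ x → ¬? (f x ℚₚ.≟ g x))) ⟩
  fromℕ (sumℕ (λ x → indicator (¬? (f x ℚₚ.≟ g x))))
    ≡⟨ fromℕ-sumℕ (λ x → indicator (¬? (f x ℚₚ.≟ g x))) ⟩
  pow2 d * 𝔼 (λ x → fromℕ (indicator (¬? (f x ℚₚ.≟ g x))))
    ≤⟨ *-monoˡ (pow2-nonNeg d) (ℚₚ.≤-trans (𝔼-mono differ) (ℚₚ.≤-trans (proj₂ (proj₂ regression))
         (*-monoˡ (0≤p+q 0≤K 0≤K) (𝔼-mono (λ x → root-mono (violations≤ x)))))) ⟩
  pow2 d * ((K + K) * 𝔼 (λ x → root (Iminus f x))) ∎)
  where
  open ℚₚ.≤-Reasoning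
  regression = Regression.isotone-approximation 0≤K (rank f) approximate
  h : Cube d → ℕ
  h = proj₁ regression
  g : Cube d → ℚ
  -- It agrees with f wherever h equals the rank, so only points with h above or below the rank
  -- count.
  g x = unrank f (h x)
  violations≤ : ∀ x → violations (rank f) x ℕ.≤ Iminus f x
  violations≤ x = subst (violations (rank f) x ℕ.≤_)
    (sym (length-filter-up (λ y → f y ℚₚ.<? f x) x))
    (outZeros-antitone (λ y → not (does (f y ℚₚ.<? f x))) (λ y → does (rank f x ℕ.≤? rank f y)) x
      (λ y _ → step (f y ℚₚ.<? f x) (rank f x ℕ.≤? rank f y) (λ fy≮fx → rank-mono f {x} {y} (ℚₚ.≮⇒≥ fy≮fx))))
    where
    step : ∀ {P Q : Set} (p? : Dec P) (q? : Dec Q) → (¬ P → Q) → not (does p?) B.≤ does q?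
    step (yes _) q?      _    = Boolₚ.≤-minimum _
    step (no _)  (yes _) _    = Boolₚ.≤-refl
    step (no ¬p) (no ¬q) ¬P→Q = ⊥-elim (¬q (¬P→Q ¬p))
  differ : ∀ x → fromℕ (indicator (¬? (f x ℚₚ.≟ g x))) ≤ ι (does (h x ℕ.<? rank f x)) + ι (does (rank f x ℕ.<? h x))
  differ x = step (f x ℚₚ.≟ g x) (h x ℕ.<? rank f x) (rank f x ℕ.<? h x)
    (λ h≡ρ → sym (trans (cong (unrank f) h≡ρ) (unrank-rank f x)))
    where
    step : ∀ {P : Set} (p? : Dec P) (a : Dec (h x ℕ.< rank f x)) (b : Dec (rank f x ℕ.< h x)) → (h x ≡ rank f x → P) →
      fromℕ (indicator (¬? p?)) ≤ ι (does a) + ι (does b)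
    step (yes _) a       b       _ = 0≤p+q (ι-nonNeg (does a)) (ι-nonNeg (does b))
    step (no _)  (yes _) b       _ = ≤-from-diff refl (ι-nonNeg (does b))
    step (no _)  (no _)  (yes _) _ = ℚₚ.≤-reflexive refl
    step (no ¬p) (no ¬a) (no ¬b) e = ⊥-elim (¬p (e (ℕₚ.≤-antisym (ℕₚ.≮⇒≥ ¬b) (ℕₚ.≮⇒≥ ¬a))))

-- `root` may exceed √n, so the final witness is halved; `¼ · 9/8 = 9/32` leaves room.
¼root²≤ : ∀ n → (½ * root n) * (½ * root n) ≤ + n / 1
¼root²≤ n = begin
  (½ * root n) * (½ * root n)    ≡⟨ lem₁ (root n) ⟩
  (½ * ½) * (root n * root n)    ≤⟨ *-monoˡ (0≤p*q 0≤½ 0≤½) (root²≤9/8n n) ⟩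
  (½ * ½) * (9/8 * fromℕ n)
    ≤⟨ ≤-from-diff (lem₂ (fromℕ n)) (0≤p*q (toWitness {a? = 0ℚ ℚₚ.≤? 1ℚ - ½ * ½ * 9/8} _) (fromℕ-nonNeg n)) ⟩
  fromℕ n                        ≡⟨ fromℕ≡/1 n ⟩
  + n / 1                        ∎
  where
  open ℚₚ.≤-Reasoning
  lem₁ : ∀ p → (½ * p) * (½ * p) ≡ (½ * ½) * (p * p)
  lem₁ = solve-∀ ℚ-ring
  lem₂ : ∀ p → p ≡ (½ * ½) * (9/8 * p) + (1ℚ - ½ * ½ * 9/8) * p
  lem₂ = solve-∀ ℚ-ring

-- This is `½ / 362`: ½ from halving the root, and 362 = 2 · 181 from the two sides of the
-- regression.
C₀ : ℚ
C₀ = + 1 / 724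

C₀*362≡½ : C₀ * ((+ 181 / 1) + (+ 181 / 1)) ≡ ½
C₀*362≡½ = refl

theorem1p1 : Σ ℚ λ C → (0ℚ < C) ×
    (∀ (d : ℕ) → d ≥ 1 → ∀ (f : Cube d → ℚ) →
    Σ (Cube d → ℚ) λ g → Monotone g ×
    Σ (Cube d → ℚ) λ r →
    (∀ x → 0ℚ ≤ r x) × (∀ x → r x * r x ≤ (+ Iminus f x) / 1) ×
    (C * ((+ disagree f g) / 1) ≤ sumCube r))
theorem1p1 = C₀ , toWitness {a? = 0ℚ ℚₚ.<? C₀} _ , λ d _ f →
  let g , monotone , disagree≤ = monotone-approximation (toWitness {a? = 0ℚ ℚₚ.≤? + 181 / 1} _) boolean-approximation f
      r = λ x → ½ * root (Iminus f x)
  in g , monotone , r , (λ x → 0≤p*q 0≤½ (root-nonNeg (Iminus f x))) , (λ x → ¼root²≤ (Iminus f x)) ,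
     bound f g ((+ 181 / 1) + (+ 181 / 1)) C₀*362≡½ disagree≤
  where
  bound : ∀ {d} (f g : Cube d → ℚ) L → C₀ * L ≡ ½ → fromℕ (disagree f g) ≤ pow2 d * (L * 𝔼 (λ x → root (Iminus f x))) →
    C₀ * ((+ disagree f g) / 1) ≤ sumCube (λ x → ½ * root (Iminus f x))
  bound {d} f g L C₀*L≡½ disagree≤ = begin
    C₀ * ((+ disagree f g) / 1)               ≡⟨ cong (λ h → C₀ * h) (sym (fromℕ≡/1 (disagree f g))) ⟩
    C₀ * fromℕ (disagree f g)                 ≤⟨ *-monoˡ (toWitness {a? = 0ℚ ℚₚ.≤? C₀} _) disagree≤ ⟩
    C₀ * (pow2 d * (L * e))                   ≡⟨ lem C₀ L (pow2 d) e ⟩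
    pow2 d * (C₀ * L * e)                     ≡⟨ cong (λ h → pow2 d * (h * e)) C₀*L≡½ ⟩
    pow2 d * (½ * e)                          ≡⟨ cong (λ h → pow2 d * h) (sym (𝔼-* ½ (λ x → root (Iminus f x)))) ⟩
    pow2 d * 𝔼 (λ x → ½ * root (Iminus f x))  ≡⟨ sym (sumCube-𝔼 (λ x → ½ * root (Iminus f x))) ⟩
    sumCube (λ x → ½ * root (Iminus f x))     ∎
    where
    open ℚₚ.≤-Reasoning
    e = 𝔼 (λ x → root (Iminus f x))
    lem : ∀ c k p e → c * (p * (k * e)) ≡ p * (c * k * e)
    lem = solve-∀ ℚ-ring
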